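{- Let $A$ be an algebra in a semidegenerate congruence modular variety such that $K(A)$ is closed under the commutator, and assume the reticulation of $A$ preserves the Boolean center. Then for every $\alpha\in B(Con(A))$ the set $D_A(\alpha)$ is clopen in $Spec(A)$, and the map $B(Con(A))\rightarrow Clop(Spec(A))$, $\alpha\mapsto D_A(\alpha)$, is a Boolean isomorphism.
   Context: $\mathcal{V}$ is a congruence modular, semidegenerate variety (no nontrivial algebra has a one-element subalgebra; equivalently $\nabla_A$ is compact) of finite signature; $A\in\mathcal{V}$. $Con(A)$ is the congruence lattice with bounds $\Delta_A,\nabla_A$, $[\cdot,\cdot]$ the Freese–McKenzie commutator, $K(A)$ the compact congruences. $[\alpha,\alpha]^0=\alpha$, $[\alpha,\alpha]^{n+1}=[[\alpha,\alpha]^n,[\alpha,\alpha]^n]$. A congruence $\phi\neq\nabla_A$ is prime if $[\alpha,\beta]\subseteq\phi$ implies $\alpha\subseteq\phi$ or $\beta\subseteq\phi$; $Spec(A)$ is the set of primes; $\rho(\theta)$ is the intersection of primes containing $\theta$; $V_A(\theta)=\{\phi\in Spec(A):\theta\subseteq\phi\}$, $D_A(\theta)=Spec(A)\setminus V_A(\theta)$, and the sets $D_A(\theta)$, $\theta\in Con(A)$, are the open sets of the topology on $Spec(A)$. $Clop(X)$ is the Boolean algebra of clopen subsets of $X$. $B(Con(A))$ is the Boolean algebra of complemented elements of $Con(A)$. The reticulation $L(A)=K(A)/{\equiv}$ ($\alpha\equiv\beta$ iff $\rho(\alpha)=\rho(\beta)$) is a bounded distributive lattice with canonical map $\lambda_A:K(A)\to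 L(A)$; $\lambda_A$ maps $B(Con(A))$ injectively into the Boolean center $B(L(A))$ (complemented elements of $L(A)$). The reticulation of $A$ preserves the Boolean center if $\lambda_A|_{B(Con(A))}:B(Con(A))\to B(L(A))$ is surjective. -}

module Defs where

open import Level using (Level; suc; _⊔_)
open import Algebra.Lattice.Bundles using (BooleanAlgebra)
open import Algebra.Lattice.Structures using (IsBooleanAlgebra)
open import Algebra.Lattice.Structures.Biased using (isDistributiveLatticeʳʲᵐ; isBooleanAlgebraʳ)
open import Algebra.Lattice.Morphism.Structures using (IsLatticeIsomorphism)
open import Axiom.ExcludedMiddle using (ExcludedMiddle)
open import Data.Fin.Base using (Fin)
open import Data.List.Base using (List; []; _∷_; _++_; concat; concatMap; tabulate; catMaybes)
open import Data.List.Membership.Propositional using (_∈_)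
open import Data.List.Membership.Propositional.Properties using (∈-++⁺ˡ; ∈-++⁺ʳ; ∈-concat⁺′; ∈-tabulate⁺; ∈-map⁺)
open import Data.List.Relation.Unary.Any using (here; there)
open import Data.Maybe.Base using (Maybe; just; nothing)
open import Data.Nat.Base using (ℕ)
open import Data.Product.Base using (∃; ∃-syntax; Σ-syntax; _×_; _,_; proj₁; proj₂; swap)
open import Data.Sum.Base as Sum using (_⊎_; inj₁; inj₂)
import Data.Unit.Polymorphic.Base as Unit
open import Function.Base using (_∘_; const; id; _on_)
open import Function.Definitions using (Surjective)
open import Relation.Binary.Bundles using (Setoid; Poset)
open import Relation.Binary.Core using (Rel; _⇒_; _⇔_)
open import Relation.Binary.Definitions using (Symmetric; Transitive)
open import Relation.Binary.Lattice.Bundles using (BoundedLattice)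
open import Relation.Binary.PropositionalEquality.Core as ≡ using (_≡_)
open import Relation.Binary.Structures using (IsEquivalence)
open import Relation.Nullary.Decidable.Core using (yes; no)
open import Relation.Nullary.Negation.Core using (¬_; contradiction)
open import Relation.Unary using (Pred; _≐_; ∁; _∪_; _∩_)
import Relation.Unary.Polymorphic as Unary
import Relation.Binary.Lattice.Properties.Lattice as LatticeProperties

private
  variable
    c ℓ ℓ₁ ℓ₂ c′ ℓ′ : Level

ZornsLemma : ∀ c ℓ₁ ℓ₂ → Set (suc (c ⊔ ℓ₁ ⊔ ℓ₂))
ZornsLemma c ℓ₁ ℓ₂ = (P : Poset c ℓ₁ ℓ₂) → let open Poset P in
  (∀ (C : Pred Carrier c) →
     (∀ x y → C x → C y → x ≤ y ⊎ y ≤ x) →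
     ∃[ u ] ∀ x → C x → x ≤ u) →
  ∃[ m ] ∀ x → m ≤ x → x ≈ m

module _ (L : BoundedLattice c ℓ₁ ℓ₂) where
  open BoundedLattice L

  Modular : Set (c ⊔ ℓ₁ ⊔ ℓ₂)
  Modular = ∀ x y z → x ≤ z → (x ∨ (y ∧ z)) ≈ ((x ∨ y) ∧ z)

  Complements : Rel Carrier ℓ₁
  Complements x y = (x ∨ y) ≈ ⊤ × (x ∧ y) ≈ ⊥

  Complemented : Pred Carrier (c ⊔ ℓ₁)
  Complemented x = ∃[ y ] Complements x y

  Centre : Set (c ⊔ ℓ₁)
  Centre = ∃ Complemented

  _≈ᶜ_ : Rel Centre ℓ₁
  _≈ᶜ_ = _≈_ on proj₁

  private
    open import Relation.Binary.Lattice.Properties.JoinSemilattice joinSemilattice using (∨-comm)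
    open import Relation.Binary.Lattice.Properties.MeetSemilattice meetSemilattice using (∧-comm)

  Complements-sym : Symmetric Complements
  Complements-sym {x} {y} (p , q) = Eq.trans (∨-comm y x) p , Eq.trans (∧-comm y x) q

  ¬ᶜ_ : Centre → Centre
  ¬ᶜ (x , y , p) = y , x , Complements-sym p

  ⊤ᶜ ⊥ᶜ : Centre
  ⊤ᶜ = ⊤ , ⊥ , antisym (maximum _) (x≤x∨y ⊤ ⊥) , antisym (x∧y≤y ⊤ ⊥) (minimum _)
  ⊥ᶜ = ¬ᶜ ⊤ᶜ

  -- The complemented elements form a Boolean algebra under the
  -- operations inherited from L.  Since _≈ᶜ_ ignores the chosen
  -- complements, the closure proofs do not affect the algebra obtained.
  record CentreIsBoolean : Set (c ⊔ ℓ₁) where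
    field
      ∨-complemented : ∀ {x y} → Complemented x → Complemented y → Complemented (x ∨ y)
      ∧-complemented : ∀ {x y} → Complemented x → Complemented y → Complemented (x ∧ y)

    _∨ᶜ_ : Centre → Centre → Centre
    x ∨ᶜ y = proj₁ x ∨ proj₁ y , ∨-complemented (proj₂ x) (proj₂ y)

    _∧ᶜ_ : Centre → Centre → Centre
    x ∧ᶜ y = proj₁ x ∧ proj₁ y , ∧-complemented (proj₂ x) (proj₂ y)

    field
      isBooleanAlgebra : IsBooleanAlgebra _≈ᶜ_ _∨ᶜ_ _∧ᶜ_ ¬ᶜ_ ⊤ᶜ ⊥ᶜ

  centreAlgebra : CentreIsBoolean → BooleanAlgebra (c ⊔ ℓ₁) ℓ₁
  centreAlgebra b = record { isBooleanAlgebra = CentreIsBoolean.isBooleanAlgebra b }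

record IsBooleanIsomorphism (B : BooleanAlgebra c ℓ) (C : BooleanAlgebra c′ ℓ′)
  (f : BooleanAlgebra.Carrier B → BooleanAlgebra.Carrier C) : Set (c ⊔ ℓ ⊔ c′ ⊔ ℓ′) where
  private
    module B = BooleanAlgebra B
    module C = BooleanAlgebra C
  field
    isLatticeIsomorphism : IsLatticeIsomorphism B.rawLattice C.rawLattice f
    ¬-homo               : ∀ x → f (B.¬ x) C.≈ C.¬ f x
    ⊤-homo               : f B.⊤ C.≈ C.⊤
    ⊥-homo               : f B.⊥ C.≈ C.⊥

record Signature : Set where
  field
    size  : ℕ
    arity : Fin size → ℕ

module _ (S : Signature) where
  open Signature S

  data Term (X : Set) : Set where
    var : X → Term X
    op  : (f : Fin size) → (Fin (arity f) → Term X) → Term X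

  -- Carriers are setoids, so that quotients by congruences exist; the
  -- equality plays the role of identity.  Empty carriers are not
  -- excluded.
  record Algebra (ℓ : Level) : Set (suc ℓ) where
    field
      setoid : Setoid ℓ ℓ
    open Setoid setoid public
    field
      ⟦_⟧     : (f : Fin size) → (Fin (arity f) → Carrier) → Carrier
      ⟦_⟧-cong : ∀ f {xs ys : Fin (arity f) → Carrier} → (∀ i → xs i ≈ ys i) → ⟦ f ⟧ xs ≈ ⟦ f ⟧ ys

    eval : ∀ {X} → Term X → (X → Carrier) → Carrier
    eval (var x)   η = η x
    eval (op f ts) η = ⟦ f ⟧ (λ i → eval (ts i) η)

  -- A variety is given by a set of identities axiomatising it.
  Variety : (ℓ : Level) → Set (suc ℓ)
  Variety ℓ = Pred (Term ℕ × Term ℕ) ℓ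

  _⊨_ : Algebra ℓ → Variety ℓ → Set ℓ
  A ⊨ V = ∀ s t → V (s , t) → ∀ η → eval s η ≈ eval t η
    where open Algebra A

module _ {S : Signature} (A : Algebra S ℓ) where
  open Signature S
  open Algebra A

  record Congruence : Set (suc ℓ) where
    field
      _∼_             : Rel Carrier ℓ
      ∼-isEquivalence : IsEquivalence _∼_
      ≈⇒∼             : _≈_ ⇒ _∼_
      compatible      : ∀ f {xs ys : Fin (arity f) → Carrier} → (∀ i → xs i ∼ ys i) → ⟦ f ⟧ xs ∼ ⟦ f ⟧ ys
    open IsEquivalence ∼-isEquivalence public renaming (refl to ∼-refl; sym to ∼-sym; trans to ∼-trans) using ()

  IsSubuniverse : Pred Carrier ℓ → Set ℓ
  IsSubuniverse U = ∀ f (xs : Fin (arity f) → Carrier) → (∀ i → U (xs i)) → U (⟦ f ⟧ xs)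

  HasOneElementSubalgebra : Set ℓ
  HasOneElementSubalgebra = ∃[ a ] IsSubuniverse (_≈ a)

  Nontrivial : Set ℓ
  Nontrivial = ∃[ x ] ∃[ y ] ¬ (x ≈ y)

module _ {S : Signature} {A : Algebra S ℓ} where
  open Signature S
  open Algebra A
  open Congruence

  infix 4 _⊆_ _≋_

  record _⊆_ (α β : Congruence A) : Set ℓ where
    constructor incl
    field
      app : _∼_ α ⇒ _∼_ β
  open _⊆_ public

  _≋_ : Rel (Congruence A) ℓ
  α ≋ β = α ⊆ β × β ⊆ α

  ⊆-refl : ∀ {α} → α ⊆ α
  ⊆-refl = incl id

  ⊆-trans : Transitive _⊆_
  ⊆-trans p q = incl (app q ∘ app p)

  eval-compatible : ∀ (α : Congruence A) {X} (t : Term S X) {η η′ : X → Carrier} →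
                    (∀ x → _∼_ α (η x) (η′ x)) → _∼_ α (eval t η) (eval t η′)
  eval-compatible α (var x)   p = p x
  eval-compatible α (op f ts) p = compatible α f (λ i → eval-compatible α (ts i) p)

  Δ : Congruence A
  Δ = record
    { _∼_             = _≈_
    ; ∼-isEquivalence = Algebra.isEquivalence A
    ; ≈⇒∼             = id
    ; compatible      = ⟦_⟧-cong
    }

  ∇ : Congruence A
  ∇ = record
    { _∼_             = λ _ _ → Unit.⊤
    ; ∼-isEquivalence = _
    ; ≈⇒∼             = _
    ; compatible      = _
    }

  _⊓_ : Congruence A → Congruence A → Congruence A
  α ⊓ β = record
    { _∼_             = λ x y → _∼_ α x y × _∼_ β x y
    ; ∼-isEquivalence = record
      { refl  = ∼-refl α , ∼-refl β
      ; sym   = λ (p , q) → ∼-sym α p , ∼-sym β q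
      ; trans = λ (p , q) (p′ , q′) → ∼-trans α p p′ , ∼-trans β q q′
      }
    ; ≈⇒∼             = λ p → ≈⇒∼ α p , ≈⇒∼ β p
    ; compatible      = λ f ps → compatible α f (proj₁ ∘ ps) , compatible β f (proj₂ ∘ ps)
    }

  data Generated (R : Rel Carrier ℓ) : Rel Carrier ℓ where
    base       : ∀ {x y} → R x y → Generated R x y
    equal      : ∀ {x y} → x ≈ y → Generated R x y
    symm       : ∀ {x y} → Generated R x y → Generated R y x
    transitive : ∀ {x y z} → Generated R x y → Generated R y z → Generated R x z
    compat     : ∀ f {xs ys : Fin (arity f) → Carrier} →
                 (∀ i → Generated R (xs i) (ys i)) → Generated R (⟦ f ⟧ xs) (⟦ f ⟧ ys)

  Cg : Rel Carrier ℓ → Congruence A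
  Cg R = record
    { _∼_             = Generated R
    ; ∼-isEquivalence = record { refl = equal refl ; sym = symm ; trans = transitive }
    ; ≈⇒∼             = equal
    ; compatible      = compat
    }

  Cg-least : ∀ {R} (α : Congruence A) → R ⇒ _∼_ α → Cg R ⊆ α
  Cg-least {R} α h = incl go
    where
    go : Generated R ⇒ _∼_ α
    go (base r)         = h r
    go (equal p)        = ≈⇒∼ α p
    go (symm p)         = ∼-sym α (go p)
    go (transitive p q) = ∼-trans α (go p) (go q)
    go (compat f ps)    = compatible α f (λ i → go (ps i))

  _⊔ᶜ_ : Congruence A → Congruence A → Congruence A
  α ⊔ᶜ β = Cg (λ x y → _∼_ α x y ⊎ _∼_ β x y)

  ⋁ : {I : Set ℓ} → (I → Congruence A) → Congruence A
  ⋁ β = Cg (λ x y → ∃[ i ] _∼_ (β i) x y)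

  ⋁-upper : ∀ {I : Set ℓ} (β : I → Congruence A) i → β i ⊆ ⋁ β
  ⋁-upper β i = incl (λ p → base (i , p))

  ⋁-least : ∀ {I : Set ℓ} (β : I → Congruence A) {γ} → (∀ i → β i ⊆ γ) → ⋁ β ⊆ γ
  ⋁-least β {γ} h = Cg-least γ (λ (i , p) → app (h i) p)

  restrict : ∀ {I : Set ℓ} → (I → Congruence A) → (is : List I) → ∃ (_∈ is) → Congruence A
  restrict β is = β ∘ proj₁

  Compact : Pred (Congruence A) (suc ℓ)
  Compact α = ∀ {I : Set ℓ} (β : I → Congruence A) → α ⊆ ⋁ β → ∃[ is ] α ⊆ ⋁ (restrict β is)

  -- The term condition: α centralises β modulo δ.
  Centralises : (α β δ : Congruence A) → Set ℓ
  Centralises α β δ = ∀ {m n} (t : Term S (Fin m ⊎ Fin n)) (a b : Fin m → Carrier) (c d : Fin n → Carrier) →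
    (∀ i → _∼_ α (a i) (b i)) → (∀ j → _∼_ β (c j) (d j)) →
    _∼_ δ (eval t Sum.[ a , c ]) (eval t Sum.[ a , d ]) →
    _∼_ δ (eval t Sum.[ b , c ]) (eval t Sum.[ b , d ])

  -- The commutator [ α , β ] is the least congruence δ with
  -- Centralises α β δ (see commutator-centralises, commutator-least).
  -- It is generated inductively, as an intersection over all such δ
  -- would leave the universe of congruences.
  data Commutator (α β : Congruence A) : Rel Carrier ℓ where
    equal      : ∀ {x y} → x ≈ y → Commutator α β x y
    symm       : ∀ {x y} → Commutator α β x y → Commutator α β y x
    transitive : ∀ {x y z} → Commutator α β x y → Commutator α β y z → Commutator α β x z
    compat     : ∀ f {xs ys : Fin (arity f) → Carrier} →
                 (∀ i → Commutator α β (xs i) (ys i)) → Commutator α β (⟦ f ⟧ xs) (⟦ f ⟧ ys)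
    centralise : ∀ {m n} (t : Term S (Fin m ⊎ Fin n)) (a b : Fin m → Carrier) (c d : Fin n → Carrier) →
                 (∀ i → _∼_ α (a i) (b i)) → (∀ j → _∼_ β (c j) (d j)) →
                 Commutator α β (eval t Sum.[ a , c ]) (eval t Sum.[ a , d ]) →
                 Commutator α β (eval t Sum.[ b , c ]) (eval t Sum.[ b , d ])

  [_,_] : Congruence A → Congruence A → Congruence A
  [ α , β ] = record
    { _∼_             = Commutator α β
    ; ∼-isEquivalence = record { refl = equal refl ; sym = symm ; trans = transitive }
    ; ≈⇒∼             = equal
    ; compatible      = compat
    }

  commutator-centralises : ∀ α β → Centralises α β [ α , β ]
  commutator-centralises α β = centralise

  commutator-least : ∀ α β δ → Centralises α β δ → [ α , β ] ⊆ δ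
  commutator-least α β δ h = incl go
    where
    go : Commutator α β ⇒ _∼_ δ
    go (equal p)                      = ≈⇒∼ δ p
    go (symm p)                       = ∼-sym δ (go p)
    go (transitive p q)               = ∼-trans δ (go p) (go q)
    go (compat f ps)                  = compatible δ f (λ i → go (ps i))
    go (centralise t a b c d ab cd p) = h t a b c d ab cd (go p)

  commutator⊆⊓ : ∀ α β → [ α , β ] ⊆ α ⊓ β
  commutator⊆⊓ α β = commutator-least α β (α ⊓ β) λ t a b c d ab cd (p , _) →
      ∼-trans α (eval-compatible α t (Sum.[ (λ i → ∼-sym α (ab i)) , (λ _ → ∼-refl α) ]))
        (∼-trans α p (eval-compatible α t (Sum.[ ab , (λ _ → ∼-refl α) ])))
    , eval-compatible β t (Sum.[ (λ _ → ∼-refl β) , cd ])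

  IsPrime : Pred (Congruence A) (suc ℓ)
  IsPrime φ = ¬ (φ ≋ ∇) × (∀ α β → [ α , β ] ⊆ φ → α ⊆ φ ⊎ β ⊆ φ)

module _ {S : Signature} (A : Algebra S ℓ) where

  Con : BoundedLattice (suc ℓ) ℓ ℓ
  Con = record
    { Carrier          = Congruence A
    ; _≈_              = _≋_
    ; _≤_              = _⊆_
    ; _∨_              = _⊔ᶜ_
    ; _∧_              = _⊓_
    ; ⊤                = ∇
    ; ⊥                = Δ
    ; isBoundedLattice = record
      { isLattice = record
        { isPartialOrder = record
          { isPreorder = record
            { isEquivalence = record
              { refl  = ⊆-refl , ⊆-refl
              ; sym   = swap
              ; trans = λ (p , q) (p′ , q′) → ⊆-trans p p′ , ⊆-trans q′ q
              }
            ; reflexive = proj₁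
            ; trans     = ⊆-trans
            }
          ; antisym = _,_
          }
        ; supremum = λ α β →
            incl (base ∘ inj₁) , incl (base ∘ inj₂)
          , λ γ p q → Cg-least γ Sum.[ app p , app q ]
        ; infimum = λ α β →
            incl proj₁ , incl proj₂ , λ γ p q → incl (λ r → app p r , app q r)
        }
      ; maximum = λ α → incl _
      ; minimum = λ α → incl (Congruence.≈⇒∼ α)
      }
    }

module _ {S : Signature} (V : Variety S ℓ) where

  CongruenceModular : Set (suc ℓ)
  CongruenceModular = ∀ (B : Algebra S ℓ) → _⊨_ S B V → Modular (Con B)

  Semidegenerate : Set (suc ℓ)
  Semidegenerate = ∀ (B : Algebra S ℓ) → _⊨_ S B V → Nontrivial B → ¬ HasOneElementSubalgebra B

module _ {S : Signature} {A : Algebra S ℓ} where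
  open Signature S
  open Algebra A
  open Congruence

  restrict-mono : ∀ {I : Set ℓ} (β : I → Congruence A) {is js : List I} →
                  (∀ {i} → i ∈ is → i ∈ js) → ⋁ (restrict β is) ⊆ ⋁ (restrict β js)
  restrict-mono β h = ⋁-least _ (λ (i , i∈is) → ⋁-upper (restrict β _) (i , h i∈is))

  ⋁-finite : ∀ {I : Set ℓ} (β : I → Congruence A) {x y} → _∼_ (⋁ β) x y →
             ∃[ is ] _∼_ (⋁ (restrict β is)) x y
  ⋁-finite β (base (i , p))   = i ∷ [] , base ((i , here ≡.refl) , p)
  ⋁-finite β (equal p)        = [] , equal p
  ⋁-finite β (symm p)         = let is , q = ⋁-finite β p in is , symm q
  ⋁-finite β (transitive p q) =
    let is , p′ = ⋁-finite β p
        js , q′ = ⋁-finite β q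
    in is ++ js , transitive (app (restrict-mono β ∈-++⁺ˡ) p′) (app (restrict-mono β (∈-++⁺ʳ is)) q′)
  ⋁-finite β (compat f ps)    =
    let iss = λ i → proj₁ (⋁-finite β (ps i))
    in concat (tabulate iss) , compat f λ i →
         app (restrict-mono β (λ k∈ → ∈-concat⁺′ k∈ (∈-tabulate⁺ {f = iss} i))) (proj₂ (⋁-finite β (ps i)))

  Cg-finite-compact : ∀ {n} (l r : Fin n → Carrier) → Compact (Cg (λ x y → ∃[ i ] (l i ≈ x × r i ≈ y)))
  Cg-finite-compact l r β h =
      concat (tabulate iss)
    , Cg-least (⋁ (restrict β _)) λ (i , p , q) →
        transitive (equal (sym p)) (transitive (app (mono i) (proj₂ (fin i))) (equal q))
    where
    fin : ∀ i → ∃[ is ] _∼_ (⋁ (restrict β is)) (l i) (r i)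
    fin i = ⋁-finite β (app h (base (i , refl , refl)))
    iss = λ i → proj₁ (fin i)
    mono : ∀ i → ⋁ (restrict β (iss i)) ⊆ ⋁ (restrict β (concat (tabulate iss)))
    mono i = restrict-mono β (λ k∈ → ∈-concat⁺′ k∈ (∈-tabulate⁺ {f = iss} i))

  Compact-resp-≋ : ∀ {α α′ : Congruence A} → α ≋ α′ → Compact α → Compact α′
  Compact-resp-≋ (p , q) k β h = let is , h′ = k β (⊆-trans p h) in is , ⊆-trans q h′

  Δ-compact : Compact (Δ {A = A})
  Δ-compact β _ = [] , incl equal

  ⊔-compact : ∀ {α β : Congruence A} → Compact α → Compact β → Compact (α ⊔ᶜ β)
  ⊔-compact {α} {β} kα kβ γ h =
    let is , p = kα γ (⊆-trans (incl (base ∘ inj₁)) h)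
        js , q = kβ γ (⊆-trans (incl (base ∘ inj₂)) h)
    in is ++ js , Cg-least (⋁ (restrict γ (is ++ js)))
         Sum.[ app (⊆-trans p (restrict-mono γ ∈-++⁺ˡ)) , app (⊆-trans q (restrict-mono γ (∈-++⁺ʳ is))) ]

  quotient : Congruence A → Algebra S ℓ
  quotient θ = record
    { setoid   = record { Carrier = Carrier ; _≈_ = _∼_ θ ; isEquivalence = ∼-isEquivalence θ }
    ; ⟦_⟧      = ⟦_⟧
    ; ⟦_⟧-cong = compatible θ
    }

  quotient-eval : ∀ θ {X} (t : Term S X) η → _∼_ θ (Algebra.eval (quotient θ) t η) (eval t η)
  quotient-eval θ (var x)   η = ∼-refl θ
  quotient-eval θ (op f ts) η = compatible θ f (λ i → quotient-eval θ (ts i) η)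

  quotient-⊨ : ∀ (V : Variety S ℓ) θ → _⊨_ S A V → _⊨_ S (quotient θ) V
  quotient-⊨ V θ A⊨V s t s≡t η =
    ∼-trans θ (quotient-eval θ s η)
      (∼-trans θ (≈⇒∼ θ (A⊨V s t s≡t η)) (∼-sym θ (quotient-eval θ t η)))

-- For any a, the finitely many pairs (f(a,…,a) , a) generate ∇, since
-- {a} is a subalgebra of the quotient they determine.
∇-compact : (∀ a → ExcludedMiddle a) → ∀ {S : Signature} (V : Variety S ℓ) → Semidegenerate V →
            (A : Algebra S ℓ) → _⊨_ S A V → Compact (∇ {A = A})
∇-compact {ℓ = ℓ} em {S} V sd A A⊨V with em ℓ {Algebra.Carrier A}
... | no  empty = λ β _ → [] , incl (λ {x} _ → contradiction x empty)
... | yes a     = Compact-resp-≋ (incl _ , incl λ _ → collapse _ _) (Cg-finite-compact l r)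
  where
  open Algebra A using (Carrier; ⟦_⟧; _≈_; refl)
  l r : Fin (Signature.size S) → Carrier
  l f = ⟦ f ⟧ (const a)
  r f = a
  θ : Congruence A
  θ = Cg (λ x y → ∃[ f ] (l f ≈ x × r f ≈ y))
  idempotent : HasOneElementSubalgebra (quotient θ)
  idempotent = a , λ f xs xs∼a → transitive (compat f xs∼a) (base (f , refl , refl))
  collapse : ∀ x y → Generated _ x y
  collapse x y with em ℓ {Congruence._∼_ θ x y}
  ... | yes p = p
  ... | no ¬p = contradiction idempotent (sd (quotient θ) (quotient-⊨ V θ A⊨V) (x , y , ¬p))

module _ {S : Signature} {A : Algebra S ℓ} where
  open Algebra A
  open Congruence

  complemented⇒compact : Modular (Con A) → Compact (∇ {A = A}) →
                         ∀ {α} → Complemented (Con A) α → Compact α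
  complemented⇒compact mod ∇c {α} (β , (_ , ∇⊆α∨β) , (α∧β⊆Δ , _)) {K} δ α⊆⋁δ = ks , ⊆-trans α⊆γ γ⊆
    where
    I : Set ℓ
    I = Σ[ (x , y) ∈ Carrier × Carrier ] _∼_ α x y
    principal : I → Congruence A
    principal ((x , y) , _) = Cg (λ u v → u ≡ x × v ≡ y)
    family : Maybe I → Congruence A
    family nothing  = β
    family (just i) = principal i
    covered : ∇ ⊆ ⋁ family
    covered = ⊆-trans ∇⊆α∨β (Cg-least (⋁ family) Sum.[
      (λ {p → base (just (_ , p) , base (≡.refl , ≡.refl))}) , (λ p → base (nothing , p)) ])
    js : List (Maybe I)
    js = proj₁ (∇c family covered)
    is : List I
    is = catMaybes js
    γ : Congruence A
    γ = ⋁ (restrict principal is)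
    ∈-catMaybes : ∀ {i} (js : List (Maybe I)) → just i ∈ js → i ∈ catMaybes js
    ∈-catMaybes (just _ ∷ js)  (here ≡.refl) = here ≡.refl
    ∈-catMaybes (just _ ∷ js)  (there p)     = there (∈-catMaybes js p)
    ∈-catMaybes (nothing ∷ js) (there p)     = ∈-catMaybes js p
    γ⊆α : γ ⊆ α
    γ⊆α = ⋁-least _ λ ((_ , p) , _) → Cg-least α λ {(≡.refl , ≡.refl) → p}
    ∇⊆γ∨β : ∇ ⊆ γ ⊔ᶜ β
    ∇⊆γ∨β = ⊆-trans (proj₂ (∇c family covered)) (⋁-least (restrict family js) λ
      { (nothing , _) → incl (base ∘ inj₂)
      ; (just i  , m) → ⊆-trans (⋁-upper (restrict principal is) (i , ∈-catMaybes js m)) (incl (base ∘ inj₁)) })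
    α⊆γ : α ⊆ γ
    α⊆γ = ⊆-trans (incl λ p → app ∇⊆γ∨β _ , p) (⊆-trans (proj₂ (mod γ β α γ⊆α))
      (Cg-least γ Sum.[ id , (λ (q , p) → ≈⇒∼ γ (app α∧β⊆Δ (p , q))) ]))
    fin : ∀ (i : I) → ∃[ ks ] _∼_ (⋁ (restrict δ ks)) (proj₁ (proj₁ i)) (proj₂ (proj₁ i))
    fin (_ , p) = ⋁-finite δ (app α⊆⋁δ p)
    ks : List K
    ks = concatMap (proj₁ ∘ fin) is
    γ⊆ : γ ⊆ ⋁ (restrict δ ks)
    γ⊆ = ⋁-least _ λ (i , i∈is) → Cg-least (⋁ (restrict δ ks)) λ {(≡.refl , ≡.refl) →
      app (restrict-mono δ (λ k∈ → ∈-concat⁺′ k∈ (∈-map⁺ (proj₁ ∘ fin) i∈is))) (proj₂ (fin i))}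

module _ {S : Signature} (A : Algebra S ℓ) where
  open Algebra A using (Carrier)
  open Congruence

  Spec : Set (suc ℓ)
  Spec = ∃ (IsPrime {A = A})

  V : Congruence A → Pred Spec ℓ
  V θ (φ , _) = θ ⊆ φ

  D : Congruence A → Pred Spec ℓ
  D θ = ∁ (V θ)

  IsOpen : Pred (Pred Spec ℓ) (suc ℓ)
  IsOpen U = ∃[ θ ] U ≐ D θ

  IsClopen : Pred (Pred Spec ℓ) (suc ℓ)
  IsClopen U = IsOpen U × IsOpen (∁ U)

  -- The radical ρ θ quantifies over all primes, hence lives one
  -- universe above the congruences.
  ρ : Congruence A → Rel Carrier (suc ℓ)
  ρ θ x y = ∀ ((φ , _) : Spec) → θ ⊆ φ → _∼_ φ x y

  ρ-mono : ∀ {α β} → α ⊆ β → ρ α ⇒ ρ β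
  ρ-mono p r φ q = r φ (⊆-trans p q)

  ρ⇒⊆ : ∀ {α β} → ρ α ⇒ ρ β → ∀ (φ : Spec) → β ⊆ proj₁ φ → α ⊆ proj₁ φ
  ρ⇒⊆ h φ q = incl (λ p → h (λ _ α⊆ψ → app α⊆ψ p) φ q)

  module _ (em : ∀ a → ExcludedMiddle a) where
    private
      by-cases : ∀ {p} {P : Set p} → ¬ ¬ P → P
      by-cases {p} {P} ¬¬p with em p {P}
      ... | yes q = q
      ... | no ¬q = contradiction ¬q ¬¬p

      lem : ∀ {p} {P : Set p} → P ⊎ ¬ P
      lem {p} {P} with em p {P}
      ... | yes q = inj₁ q
      ... | no ¬q = inj₂ ¬q

    ∪-open : ∀ {U W : Pred Spec ℓ} → IsOpen U → IsOpen W → IsOpen (U ∪ W)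
    ∪-open (θ , p , p′) (χ , q , q′) =
        θ ⊔ᶜ χ
      , (λ { (inj₁ u) h → p u (⊆-trans (incl (base ∘ inj₁)) h)
           ; (inj₂ w) h → q w (⊆-trans (incl (base ∘ inj₂)) h) })
      , λ {(φ , _)} h → by-cases λ ¬uw →
          h (Cg-least φ Sum.[ app (by-cases (λ n → ¬uw (inj₁ (p′ n)))) , app (by-cases (λ n → ¬uw (inj₂ (q′ n)))) ])

    ∩-open : ∀ {U W : Pred Spec ℓ} → IsOpen U → IsOpen W → IsOpen (U ∩ W)
    ∩-open (θ , p , p′) (χ , q , q′) =
        [ θ , χ ]
      , (λ {(φ , _ , prime)} (u , w) h → Sum.[ p u , q w ] (prime θ χ h))
      , λ h → p′ (λ θ⊆φ → h (⊆-trans (commutator⊆⊓ θ χ) (⊆-trans (incl proj₁) θ⊆φ)))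
            , q′ (λ χ⊆φ → h (⊆-trans (commutator⊆⊓ θ χ) (⊆-trans (incl proj₂) χ⊆φ)))

    open-resp-≐ : ∀ {U W : Pred Spec ℓ} → U ≐ W → IsOpen U → IsOpen W
    open-resp-≐ (p , p′) (θ , q , q′) = θ , q ∘ p′ , p ∘ q′

    ∪-clopen : ∀ {U W : Pred Spec ℓ} → IsClopen U → IsClopen W → IsClopen (U ∪ W)
    ∪-clopen (p , p′) (q , q′) = ∪-open p q ,
      open-resp-≐ ((λ (u , w) → Sum.[ u , w ]) , (λ n → n ∘ inj₁ , n ∘ inj₂)) (∩-open p′ q′)

    ∩-clopen : ∀ {U W : Pred Spec ℓ} → IsClopen U → IsClopen W → IsClopen (U ∩ W)
    ∩-clopen (p , p′) (q , q′) = ∩-open p q ,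
      open-resp-≐ ( (λ { (inj₁ n) (u , _) → n u ; (inj₂ n) (_ , w) → n w })
                  , (λ n → by-cases λ k → k (inj₁ λ u → k (inj₂ λ w → n (u , w))))) (∪-open p′ q′)

    ∁-clopen : ∀ {U : Pred Spec ℓ} → IsClopen U → IsClopen (∁ U)
    ∁-clopen (p , p′) = p′ , open-resp-≐ ((λ u n → n u) , by-cases) p

    ∅-clopen : IsClopen Unary.∅
    ∅-clopen = (Δ , (λ ()) , λ {(φ , _)} n → contradiction (incl (≈⇒∼ φ)) n)
             , (∇ , (λ {(φ , proper , _)} _ ∇⊆φ → proper (incl _ , ∇⊆φ)) , λ _ ())

    U-clopen : IsClopen Unary.U
    U-clopen = open-resp-≐ (_ , λ _ ()) (proj₂ ∅-clopen)
             , open-resp-≐ ((λ ()) , λ n → contradiction _ n) (proj₁ ∅-clopen)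

    private
      ClopLattice : BoundedLattice (suc ℓ) (suc ℓ) (suc ℓ)
      ClopLattice = record
        { Carrier          = ∃ IsClopen
        ; _≈_              = _≐_ on proj₁
        ; _≤_              = λ (U , _) (W , _) → ∀ {φ} → U φ → W φ
        ; _∨_              = λ (U , p) (W , q) → U ∪ W , ∪-clopen p q
        ; _∧_              = λ (U , p) (W , q) → U ∩ W , ∩-clopen p q
        ; ⊤                = Unary.U , U-clopen
        ; ⊥                = Unary.∅ , ∅-clopen
        ; isBoundedLattice = record
          { isLattice = record
            { isPartialOrder = record
              { isPreorder = record
                { isEquivalence = record
                  { refl  = id , id
                  ; sym   = swap
                  ; trans = λ (p , q) (p′ , q′) → p′ ∘ p , q ∘ q′
                  }
                ; reflexive = proj₁
                ; trans     = λ p q → q ∘ p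
                }
              ; antisym = _,_
              }
            ; supremum = λ _ _ → inj₁ , inj₂ , λ _ p q → Sum.[ p , q ]
            ; infimum  = λ _ _ → proj₁ , proj₂ , λ _ p q u → p u , q u
            }
          ; maximum = _
          ; minimum = λ _ ()
          }
        }

    Clop : BooleanAlgebra (suc ℓ) (suc ℓ)
    Clop = record
      { _≈_              = _≐_ on proj₁
      ; _∨_              = BoundedLattice._∨_ ClopLattice
      ; _∧_              = BoundedLattice._∧_ ClopLattice
      ; ¬_               = λ (U , p) → ∁ U , ∁-clopen p
      ; ⊤                = BoundedLattice.⊤ ClopLattice
      ; ⊥                = BoundedLattice.⊥ ClopLattice
      ; isBooleanAlgebra = isBooleanAlgebraʳ (record
        { isDistributiveLattice = isDistributiveLatticeʳʲᵐ (record
          { isLattice    = LatticeProperties.isAlgLattice (BoundedLattice.lattice ClopLattice)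
          ; ∨-distribʳ-∧ = λ _ _ _ →
                (λ { (inj₁ (u , w)) → inj₁ u , inj₁ w ; (inj₂ x) → inj₂ x , inj₂ x })
              , (λ { (inj₁ u , inj₁ w) → inj₁ (u , w) ; (inj₂ x , _) → inj₂ x ; (inj₁ _ , inj₂ x) → inj₂ x })
          })
        ; ∨-complementʳ = λ _ → _ , λ _ → lem
        ; ∧-complementʳ = λ _ → (λ (u , n) → contradiction u n) , λ ()
        ; ¬-cong        = λ (p , q) → (λ n → n ∘ q) , (λ n → n ∘ p)
        })
      }

module _ {S : Signature} (A : Algebra S ℓ) where

  CompactCongruence : Set (suc ℓ)
  CompactCongruence = ∃ (Compact {A = A})

  CommutatorClosed : Set (suc ℓ)
  CommutatorClosed = ∀ {α β : Congruence A} → Compact α → Compact β → Compact [ α , β ]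

  module _ (∇c : Compact (∇ {A = A})) (cl : CommutatorClosed) where

    -- L(A) is K(A) with the equality ρ(α) = ρ(β), so that λ_A is the
    -- identity on underlying elements; its order is ρ(α) ⊆ ρ(β).
    Reticulation : BoundedLattice (suc ℓ) (suc ℓ) (suc ℓ)
    Reticulation = record
      { Carrier          = CompactCongruence
      ; _≈_              = λ (α , _) (β , _) → ρ A α ⇔ ρ A β
      ; _≤_              = λ (α , _) (β , _) → ρ A α ⇒ ρ A β
      ; _∨_              = λ (α , k) (β , l) → α ⊔ᶜ β , ⊔-compact k l
      ; _∧_              = λ (α , k) (β , l) → [ α , β ] , cl k l
      ; ⊤                = ∇ , ∇c
      ; ⊥                = Δ , Δ-compact
      ; isBoundedLattice = record
        { isLattice = record
          { isPartialOrder = record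
            { isPreorder = record
              { isEquivalence = record
                { refl  = id , id
                ; sym   = swap
                ; trans = λ (p , q) (p′ , q′) → (λ r → p′ (p r)) , (λ r → q (q′ r))
                }
              ; reflexive = proj₁
              ; trans     = λ p q r → q (p r)
              }
            ; antisym = _,_
            }
          ; supremum = λ (α , _) (β , _) →
              ρ-mono A (incl (base ∘ inj₁)) , ρ-mono A (incl (base ∘ inj₂))
            , λ (γ , _) p q r φ γ⊆φ → r φ (Cg-least (proj₁ φ)
                Sum.[ app (ρ⇒⊆ A {α} {γ} p φ γ⊆φ) , app (ρ⇒⊆ A {β} {γ} q φ γ⊆φ) ])
          ; infimum = λ (α , _) (β , _) →
              ρ-mono A (⊆-trans (commutator⊆⊓ α β) (incl proj₁))
            , ρ-mono A (⊆-trans (commutator⊆⊓ α β) (incl proj₂))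
            , λ _ p q r φ h → Sum.[ p r φ , q r φ ] (proj₂ (proj₂ φ) α β h)
          }
        ; maximum = λ α → ρ-mono A (incl _)
        ; minimum = λ (α , _) → ρ-mono A (incl (Congruence.≈⇒∼ α))
        }
      }

    λ-centre : Modular (Con A) → Centre (Con A) → Centre Reticulation
    λ-centre mod (α , c@(β , p@((_ , ∇⊆α∨β) , (α∧β⊆Δ , _)))) =
        (α , complemented⇒compact mod ∇c c)
      , (β , complemented⇒compact mod ∇c (α , Complements-sym (Con A) {α} {β} p))
      , (ρ-mono A (incl _) , ρ-mono A ∇⊆α∨β)
      , (ρ-mono A (⊆-trans (commutator⊆⊓ α β) α∧β⊆Δ) , ρ-mono A (incl (Congruence.≈⇒∼ [ α , β ])))

    PreservesBooleanCentre : Modular (Con A) → Set (suc ℓ)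
    PreservesBooleanCentre mod = Surjective (_≈ᶜ_ (Con A)) (_≈ᶜ_ Reticulation) (λ-centre mod)

{-# OPTIONS --safe #-}

-- The commutator theory needed is obtained straight from congruence
-- modularity, without Day or Gumm terms.  The matrices of the term
-- condition for (β , α) generate a congruence Θ on the subalgebra α of
-- A², and modularity of Con(Θ), for Θ ≤ A⁴, gives a shifting argument: if the
-- term condition C(β,α;ε) holds and ε ⊆ δ, then (x,y) Θ (u,v) and y δ v
-- imply x δ u.  Hence the commutator is symmetric and preserves joins,
-- and since the diagonal becomes a one-element subalgebra of α/Θ when
-- β = ∇, semidegeneracy gives α = [α,∇].
--
-- Consequently maximal congruences are prime, so by Zorn's lemma a
-- congruence lying in no prime is ∇; for complemented α this makes
-- D(α) ⊆ D(β) imply α ⊆ β, and α ∧ θ = [α,θ] makes the complemented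
-- congruences a Boolean algebra.  If D(θ) and D(χ) partition Spec(A),
-- then θ ∨ χ = ∇, and compactness of ∇ replaces θ and χ by finitely
-- generated congruences, which are complements in the reticulation; the
-- hypothesis then lifts the first one to a complemented congruence.
module Submission where

open import Defs
open import Algebra.Lattice.Structures using (IsLattice)
open import Algebra.Lattice.Structures.Biased using (isDistributiveLatticeʳʲᵐ; isBooleanAlgebraʳ)
open import Axiom.ExcludedMiddle using (ExcludedMiddle)
open import Data.Fin.Base using (Fin; zero; suc; splitAt; _↑ˡ_; _↑ʳ_)
open import Data.List.Base using (length; lookup)
open import Data.List.Relation.Unary.Any using (index)
open import Data.List.Relation.Unary.Any.Properties using (lookup-index)
open import Data.Nat.Base using (ℕ; zero; suc; _+_)
open import Data.Product.Base using (∃-syntax; Σ-syntax; _×_; _,_; proj₁; proj₂; swap)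
open import Data.Sum.Base as Sum using (_⊎_; inj₁; inj₂)
open import Data.Vec.Functional using (Vector; _∷_; _++_; tail)
open import Data.Vec.Functional.Properties using (lookup-++ˡ; lookup-++ʳ)
open import Function.Base using (_∘_; id)
open import Level using (Level; Lift; lift; lower) renaming (suc to lsuc)
open import Relation.Binary.Bundles using (Poset)
open import Relation.Binary.Construct.Closure.ReflexiveTransitive as Star using (Star; _◅_; _◅◅_) renaming (ε to nil)
import Relation.Binary.Construct.On as On
open import Relation.Binary.Core using (Rel; _⇒_; _⇔_)
open import Relation.Binary.Definitions using (Reflexive; Symmetric)
open import Relation.Binary.Lattice.Bundles using (BoundedLattice)
import Relation.Binary.Lattice.Properties.Lattice as LatticeProperties
open import Relation.Binary.PropositionalEquality.Core as ≡ using (_≡_)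
open import Relation.Nullary.Decidable.Core using (yes; no; True; toWitness; fromWitness; decidable-stable)
open import Relation.Nullary.Negation.Core using (¬_; contradiction)
open import Relation.Unary using (Pred; _≐_; ∁; _∪_; _∩_)

open Congruence

private
  variable
    ℓ r p : Level
    T : Set r

-- Moving tuples along chains of two relations

module _ {R Q : Rel T r} (R-refl : Reflexive R) (Q-refl : Reflexive Q) where

  -- The chains of different entries may differ in length, so the entries are moved one after
  -- another, every step being padded with reflexivity in the remaining positions.
  star-invariant : ∀ {n} (P : Pred (Vector T n) p) →
    (∀ {u v} → (∀ i → R (u i) (v i)) → P u → P v) →
    (∀ {u v} → (∀ i → Q (u i) (v i)) → P u → P v) →
    ∀ {u v} → (∀ i → Star (λ x y → R x y ⊎ Q x y) (u i) (v i)) → P u → P v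
  star-invariant {n = zero}  P R-inv Q-inv s = R-inv λ ()
  star-invariant {n = suc n} P R-inv Q-inv {u} {v} s =
    -- Vectors are functions, and `v` agrees with `v zero ∷ tail v` only pointwise; a step of
    -- reflexivities exchanges them inside `P`. The last link of the composite does the same for
    -- `u`.
    R-inv (λ { zero → R-refl ; (suc _) → R-refl })
    ∘ star-invariant (λ w → P (v zero ∷ w))
        (λ h → R-inv λ { zero → R-refl ; (suc i) → h i })
        (λ h → Q-inv λ { zero → Q-refl ; (suc i) → h i })
        (s ∘ suc)
    ∘ move-head (s zero)
    ∘ R-inv (λ { zero → R-refl ; (suc _) → R-refl })
    where
    move-head : ∀ {x y} → Star _ x y → P (x ∷ tail u) → P (y ∷ tail u)
    move-head nil          = id
    move-head (inj₁ h ◅ t) = move-head t ∘ R-inv (λ { zero → h ; (suc _) → R-refl })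
    move-head (inj₂ h ◅ t) = move-head t ∘ Q-inv (λ { zero → h ; (suc _) → Q-refl })

-- Concatenating a family of tuples

total : ∀ {k} → Vector ℕ k → ℕ
total {zero}  m = 0
total {suc k} m = m zero + total (tail m)

position : ∀ {k} (m : Vector ℕ k) i → Fin (m i) → Fin (total m)
position m zero    j = j ↑ˡ total (tail m)
position m (suc i) j = m zero ↑ʳ position (tail m) i j

gather : ∀ {k} (m : Vector ℕ k) → (∀ i → Vector T (m i)) → Vector T (total m)
gather {k = zero}  m a = λ ()
gather {k = suc k} m a = a zero ++ gather (tail m) (a ∘ suc)

gather-position : ∀ {k} (m : Vector ℕ k) (a : ∀ i → Vector T (m i)) i j →
                  gather m a (position m i j) ≡ a i j
gather-position m a zero    j = lookup-++ˡ (a zero) _ j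
gather-position m a (suc i) j = ≡.trans (lookup-++ʳ (a zero) _ _) (gather-position (tail m) (a ∘ suc) i j)

gather-related : ∀ {k} (m : Vector ℕ k) {R : Rel T r} {a b : ∀ i → Vector T (m i)} →
                 (∀ i j → R (a i j) (b i j)) → ∀ v → R (gather m a v) (gather m b v)
gather-related {k = suc k} m {R} h v with splitAt (m zero) v
... | inj₁ j = h zero j
... | inj₂ w = gather-related (tail m) {R = R} (h ∘ suc) w

-- Congruences by chains, the term condition on joins, the algebra of pairs

module _ {S : Signature} where

  rename : ∀ {X Y : Set} → (X → Y) → Term S X → Term S Y
  rename ρ (var x)   = var (ρ x)
  rename ρ (op f ts) = op f (λ i → rename ρ (ts i))

module _ {S : Signature} {A : Algebra S ℓ} where
  open Signature S
  open Algebra A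

  eval-rename : ∀ {X Y : Set} (ρ : X → Y) (t : Term S X) {η : X → Carrier} {θ : Y → Carrier} →
                (∀ x → θ (ρ x) ≈ η x) → eval (rename ρ t) θ ≈ eval t η
  eval-rename ρ (var x)   h = h x
  eval-rename ρ (op f ts) h = ⟦ f ⟧-cong (λ i → eval-rename ρ (ts i) h)

  starCongruence : (R : Rel Carrier ℓ) → _≈_ ⇒ R → Symmetric R →
    (∀ f {xs ys : Fin (arity f) → Carrier} → (∀ i → R (xs i) (ys i)) → R (⟦ f ⟧ xs) (⟦ f ⟧ ys)) →
    Congruence A
  starCongruence R ≈⇒R R-sym R-compatible = record
    { _∼_             = Star R
    ; ∼-isEquivalence = record { refl = nil ; sym = Star.reverse R-sym ; trans = _◅◅_ }
    ; ≈⇒∼             = λ h → ≈⇒R h ◅ nil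
    ; compatible      = λ f {xs} hs →
        let inv = λ {us} {vs} h s → s ◅◅ R-compatible f {us} {vs} h ◅ nil in
        -- The left end `⟦ f ⟧ xs` stays fixed, and each simultaneous step of `ys` prolongs the
        -- chain by one link.
        star-invariant {R = R} {R} (≈⇒R refl) (≈⇒R refl) (λ ys → Star R (⟦ f ⟧ xs) (⟦ f ⟧ ys))
          inv inv (Star.map inj₁ ∘ hs) nil
    }

  ⊔ᶜ⇒star : ∀ (α β : Congruence A) → _∼_ (α ⊔ᶜ β) ⇒ Star (λ x y → _∼_ α x y ⊎ _∼_ β x y)
  ⊔ᶜ⇒star α β = go
    where
    R = λ x y → _∼_ α x y ⊎ _∼_ β x y
    go : Generated R ⇒ Star R
    go (base h)         = h ◅ nil
    go (equal h)        = inj₁ (≈⇒∼ α h) ◅ nil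
    go (symm h)         = Star.reverse Sum.[ inj₁ ∘ ∼-sym α , inj₂ ∘ ∼-sym β ] (go h)
    go (transitive h k) = go h ◅◅ go k
    go (compat f {xs} hs) = star-invariant {R = _∼_ α} {_∼_ β} (∼-refl α) (∼-refl β)
      (λ ys → Star R (⟦ f ⟧ xs) (⟦ f ⟧ ys))
      (λ h s → s ◅◅ inj₁ (compatible α f h) ◅ nil) (λ h s → s ◅◅ inj₂ (compatible β f h) ◅ nil)
      (λ i → go (hs i)) nil

  ⊆⊔ᶜˡ : ∀ (α β : Congruence A) → α ⊆ α ⊔ᶜ β
  ⊆⊔ᶜˡ α β = incl (base ∘ inj₁)

  ⊆⊔ᶜʳ : ∀ (α β : Congruence A) → β ⊆ α ⊔ᶜ β
  ⊆⊔ᶜʳ α β = incl (base ∘ inj₂)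

  ⊔ᶜ-least : ∀ {α β γ : Congruence A} → α ⊆ γ → β ⊆ γ → α ⊔ᶜ β ⊆ γ
  ⊔ᶜ-least {γ = γ} h k = Cg-least γ Sum.[ app h , app k ]

  commutator⊆ˡ : ∀ {α β : Congruence A} → [ α , β ] ⊆ α
  commutator⊆ˡ {α} {β} = ⊆-trans (commutator⊆⊓ α β) (incl proj₁)

  commutator⊆ʳ : ∀ {α β : Congruence A} → [ α , β ] ⊆ β
  commutator⊆ʳ {α} {β} = ⊆-trans (commutator⊆⊓ α β) (incl proj₂)

  centralises-antitone : ∀ {α α′ β β′ δ : Congruence A} → α ⊆ α′ → β ⊆ β′ →
                         Centralises α′ β′ δ → Centralises α β δ
  centralises-antitone h k C t a b c d ab cd = C t a b c d (app h ∘ ab) (app k ∘ cd)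

  commutator-mono : ∀ {α α′ β β′ : Congruence A} → α ⊆ α′ → β ⊆ β′ → [ α , β ] ⊆ [ α′ , β′ ]
  commutator-mono {α} {α′} {β} {β′} h k = commutator-least α β [ α′ , β′ ]
    (centralises-antitone {δ = [ α′ , β′ ]} h k (commutator-centralises α′ β′))

  -- For fixed `c` and `d` the condition is a property of the left tuple alone, stable under steps
  -- of `α` and of `β`, hence under chains of them.
  centralises-⊔ˡ : ∀ {α β γ δ : Congruence A} →
                   Centralises α γ δ → Centralises β γ δ → Centralises (α ⊔ᶜ β) γ δ
  centralises-⊔ˡ {α} {β} {γ} {δ} Cα Cβ t a b c d ab cd =
    star-invariant {R = _∼_ α} {_∼_ β} (∼-refl α) (∼-refl β)
      (λ u → _∼_ δ (eval t Sum.[ u , c ]) (eval t Sum.[ u , d ]))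
      (λ h → Cα t _ _ c d h cd) (λ h → Cβ t _ _ c d h cd)
      (⊔ᶜ⇒star α β ∘ ab)

  pairs : Congruence A → Algebra S ℓ
  pairs α = record
    { setoid = record
      { Carrier       = Σ[ (x , y) ∈ Carrier × Carrier ] _∼_ α x y
      ; _≈_           = λ ((x , y) , _) ((u , v) , _) → x ≈ u × y ≈ v
      ; isEquivalence = record
        { refl  = refl , refl
        ; sym   = λ (h , k) → sym h , sym k
        ; trans = λ (h , k) (h′ , k′) → trans h h′ , trans k k′
        }
      }
    ; ⟦_⟧      = λ f xs → (⟦ f ⟧ (proj₁ ∘ proj₁ ∘ xs) , ⟦ f ⟧ (proj₂ ∘ proj₁ ∘ xs)) , compatible α f (proj₂ ∘ xs)
    ; ⟦_⟧-cong = λ f hs → ⟦ f ⟧-cong (proj₁ ∘ hs) , ⟦ f ⟧-cong (proj₂ ∘ hs)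
    }

  module _ (α : Congruence A) where
    private module P = Algebra (pairs α)

    eval-pairs₁ : ∀ {X : Set} (t : Term S X) η → proj₁ (proj₁ (P.eval t η)) ≈ eval t (proj₁ ∘ proj₁ ∘ η)
    eval-pairs₁ (var x)   η = refl
    eval-pairs₁ (op f ts) η = ⟦ f ⟧-cong (λ i → eval-pairs₁ (ts i) η)

    eval-pairs₂ : ∀ {X : Set} (t : Term S X) η → proj₂ (proj₁ (P.eval t η)) ≈ eval t (proj₂ ∘ proj₁ ∘ η)
    eval-pairs₂ (var x)   η = refl
    eval-pairs₂ (op f ts) η = ⟦ f ⟧-cong (λ i → eval-pairs₂ (ts i) η)

    pairs-⊨ : ∀ (𝒱 : Variety S ℓ) → _⊨_ S A 𝒱 → _⊨_ S (pairs α) 𝒱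
    pairs-⊨ 𝒱 A⊨𝒱 s t s≡t η =
        trans (eval-pairs₁ s η) (trans (A⊨𝒱 s t s≡t _) (sym (eval-pairs₁ t η)))
      , trans (eval-pairs₂ s η) (trans (A⊨𝒱 s t s≡t _) (sym (eval-pairs₂ t η)))

    pull₁ pull₂ : Congruence A → Congruence (pairs α)
    pull₁ θ = record
      { _∼_             = λ ((x , _) , _) ((u , _) , _) → _∼_ θ x u
      ; ∼-isEquivalence = record { refl = ∼-refl θ ; sym = ∼-sym θ ; trans = ∼-trans θ }
      ; ≈⇒∼             = ≈⇒∼ θ ∘ proj₁
      ; compatible      = λ f → compatible θ f
      }
    pull₂ θ = record
      { _∼_             = λ ((_ , y) , _) ((_ , v) , _) → _∼_ θ y v
      ; ∼-isEquivalence = record { refl = ∼-refl θ ; sym = ∼-sym θ ; trans = ∼-trans θ }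
      ; ≈⇒∼             = ≈⇒∼ θ ∘ proj₂
      ; compatible      = λ f → compatible θ f
      }

-- Matrices of the term condition and shifting

module _ {S : Signature} {A : Algebra S ℓ} where
  open Signature S
  open Algebra A

  -- The matrices of the term condition: a row is a pair of α, and the
  -- two rows are joined by moving the first block of variables along β.
  record Matrix (β α : Congruence A) (x y u v : Carrier) : Set ℓ where
    field
      {m n} : ℕ
      term  : Term S (Fin m ⊎ Fin n)
      a b   : Fin m → Carrier
      c d   : Fin n → Carrier
      a∼b   : ∀ i → _∼_ β (a i) (b i)
      c∼d   : ∀ j → _∼_ α (c j) (d j)
      ≈x    : eval term Sum.[ a , c ] ≈ x
      ≈y    : eval term Sum.[ a , d ] ≈ y
      ≈u    : eval term Sum.[ b , c ] ≈ u
      ≈v    : eval term Sum.[ b , d ] ≈ v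

  module _ {β α : Congruence A} where
    open Matrix

    matrix-const : ∀ {x y u v} → _∼_ α x y → x ≈ u → y ≈ v → Matrix β α x y u v
    matrix-const {x} {y} h x≈u y≈v = record
      { m = 0 ; n = 1 ; term = var (inj₂ zero)
      ; a = λ () ; b = λ () ; c = λ _ → x ; d = λ _ → y
      ; a∼b = λ () ; c∼d = λ _ → h
      ; ≈x = refl ; ≈y = refl ; ≈u = x≈u ; ≈v = y≈v }

    matrix-diagonal : ∀ {x u} → _∼_ β x u → Matrix β α x x u u
    matrix-diagonal {x} {u} h = record
      { m = 1 ; n = 0 ; term = var (inj₁ zero)
      ; a = λ _ → x ; b = λ _ → u ; c = λ () ; d = λ ()
      ; a∼b = λ _ → h ; c∼d = λ ()
      ; ≈x = refl ; ≈y = refl ; ≈u = refl ; ≈v = refl }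

    matrix-sym : ∀ {x y u v} → Matrix β α x y u v → Matrix β α u v x y
    matrix-sym M = record
      { term = term M ; a = b M ; b = a M ; c = c M ; d = d M
      ; a∼b = ∼-sym β ∘ a∼b M ; c∼d = c∼d M
      ; ≈x = ≈u M ; ≈y = ≈v M ; ≈u = ≈x M ; ≈v = ≈y M }

    -- Replacing `d` by `c` repeats the first column. Chains of matrices thus become chains between
    -- diagonal elements, which supplies the corner `W` in `shift`.
    matrix-collapse : ∀ {x y u v} → Matrix β α x y u v → Matrix β α x x u u
    matrix-collapse M = record
      { term = term M ; a = a M ; b = b M ; c = c M ; d = c M
      ; a∼b = a∼b M ; c∼d = λ _ → ∼-refl α
      ; ≈x = ≈x M ; ≈y = ≈x M ; ≈u = ≈u M ; ≈v = ≈u M }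

    -- The matrices may have different terms, so their variables are made disjoint by concatenating
    -- the blocks before `f` is applied.
    matrix-compatible : ∀ f {x y u v : Fin (arity f) → Carrier} →
      (∀ i → Matrix β α (x i) (y i) (u i) (v i)) →
      Matrix β α (⟦ f ⟧ x) (⟦ f ⟧ y) (⟦ f ⟧ u) (⟦ f ⟧ v)
    matrix-compatible f Ms = record
      { term = op f λ i → rename (place i) (term (Ms i))
      ; a = gather ms (a ∘ Ms) ; b = gather ms (b ∘ Ms)
      ; c = gather ns (c ∘ Ms) ; d = gather ns (d ∘ Ms)
      ; a∼b = gather-related ms {R = _∼_ β} (a∼b ∘ Ms)
      ; c∼d = gather-related ns {R = _∼_ α} (c∼d ∘ Ms)
      ; ≈x = ⟦ f ⟧-cong λ i → trans (eval-placed (a ∘ Ms) (c ∘ Ms) i) (≈x (Ms i))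
      ; ≈y = ⟦ f ⟧-cong λ i → trans (eval-placed (a ∘ Ms) (d ∘ Ms) i) (≈y (Ms i))
      ; ≈u = ⟦ f ⟧-cong λ i → trans (eval-placed (b ∘ Ms) (c ∘ Ms) i) (≈u (Ms i))
      ; ≈v = ⟦ f ⟧-cong λ i → trans (eval-placed (b ∘ Ms) (d ∘ Ms) i) (≈v (Ms i))
      }
      where
      ms = λ i → m (Ms i)
      ns = λ i → n (Ms i)
      place : ∀ i → Fin (ms i) ⊎ Fin (ns i) → Fin (total ms) ⊎ Fin (total ns)
      place i = Sum.map (position ms i) (position ns i)
      eval-placed : ∀ (e : ∀ i → Vector Carrier (ms i)) (g : ∀ i → Vector Carrier (ns i)) i →
        eval (rename (place i) (term (Ms i))) Sum.[ gather ms e , gather ns g ] ≈ eval (term (Ms i)) Sum.[ e i , g i ]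
      eval-placed e g i = eval-rename {A = A} (place i) (term (Ms i)) λ
        { (inj₁ j) → reflexive (gather-position ms e i j)
        ; (inj₂ j) → reflexive (gather-position ns g i j) }

  -- As a relation between rows, matrices are already reflexive, symmetric and compatible; only
  -- transitivity has to be added.
  matrixCongruence : ∀ (β α : Congruence A) → Congruence (pairs α)
  matrixCongruence β α = starCongruence {A = pairs α}
    (λ ((x , y) , _) ((u , v) , _) → Matrix β α x y u v)
    (λ { {_ , h} (x≈u , y≈v) → matrix-const h x≈u y≈v }) matrix-sym (λ f → matrix-compatible f)

  centralises-rows : ∀ {α β ε : Congruence A} → Centralises β α ε →
    ∀ {P Q} → _∼_ (matrixCongruence β α) P Q →
    _∼_ ε (proj₁ (proj₁ P)) (proj₂ (proj₁ P)) → _∼_ ε (proj₁ (proj₁ Q)) (proj₂ (proj₁ Q))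
  centralises-rows             C nil     h = h
  centralises-rows {α} {β} {ε} C (M ◅ s) h = centralises-rows {α} {β} {ε} C s
    (∼-trans ε (≈⇒∼ ε (sym (≈u M))) (∼-trans ε
      (C (term M) (a M) (b M) (c M) (d M) (a∼b M) (c∼d M)
        (∼-trans ε (≈⇒∼ ε (≈x M)) (∼-trans ε h (≈⇒∼ ε (sym (≈y M))))))
      (≈⇒∼ ε (≈v M))))
    where open Matrix

  -- Shifting in the algebra of pairs of Θ = matrixCongruence β α, with
  -- elements (p₀ , q₀) Θ (p₁ , q₁).  In the rectangle
  --   X = (x,x)Θ(x,x),  Y = (x,y)Θ(x,y),  Z = (x,y)Θ(u,v),  W = (x,x)Θ(u,u)
  -- κ compares (p₀ , q₀), ν compares (p₀ , p₁) and μ compares q₁.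
  -- Modularity yields a chain from X to W inside one κ-class; there
  -- p₀ ε q₀, so p₁ ε q₁ by the term condition, and both κ ∧ ν and
  -- κ ∧ μ preserve q₁ modulo δ.
  shift : ∀ {α β ε δ : Congruence A} → Modular (Con (pairs (matrixCongruence β α))) →
    Centralises β α ε → ε ⊆ δ → ∀ {x y u v} {h : _∼_ α x y} {k : _∼_ α u v} →
    _∼_ (matrixCongruence β α) ((x , y) , h) ((u , v) , k) → _∼_ δ y v → _∼_ δ x u
  shift {α} {β} {ε} {δ} modular C ε⊆δ {x} {y} {u} {v} {h} {k} xyΘuv yδv =
    proj₂ (follow {X} {W} (⊔ᶜ⇒star (κ ⊓ μ) (ν ⊓ κ) {X} {W} XW) (∼-refl ε , ∼-refl δ))
    where
    Θ = matrixCongruence β α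
    E = Algebra.Carrier (pairs Θ)
    X Y Z W : E
    X = (((x , x) , ∼-refl α) , ((x , x) , ∼-refl α)) , ∼-refl Θ
    Y = (((x , y) , h) , ((x , y) , h)) , ∼-refl Θ
    Z = (((x , y) , h) , ((u , v) , k)) , xyΘuv
    W = (((x , x) , ∼-refl α) , ((u , u) , ∼-refl α)) , Star.gmap (λ ((x , _) , _) → (x , x) , ∼-refl α) matrix-collapse xyΘuv
    κ ν μ : Congruence (pairs Θ)
    κ = pull₁ Θ (pull₁ α ε ⊓ pull₂ α ε)
    ν = pull₁ Θ (pull₁ α ε) ⊓ pull₂ Θ (pull₁ α ε)
    μ = pull₂ Θ (pull₂ α δ)
    XW : _∼_ ((κ ⊓ μ) ⊔ᶜ (ν ⊓ κ)) X W
    XW = app (proj₂ (modular (κ ⊓ μ) ν κ (incl proj₁))) {X} {W}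
      ( transitive {x = X} {Y} {W} (base (inj₂ (∼-refl ε , ∼-refl ε)))
          (transitive {x = Y} {Z} {W} (base (inj₁ ((∼-refl ε , ∼-refl ε) , yδv))) (base (inj₂ (∼-refl ε , ∼-refl ε))))
      , (∼-refl ε , ∼-refl ε))
    Good : E → Set _
    Good ((((p₀ , q₀) , _) , ((p₁ , q₁) , _)) , _) = _∼_ ε p₀ q₀ × _∼_ δ x q₁
    rows : ∀ (e : E) → Good e → _∼_ ε (proj₁ (proj₁ (proj₂ (proj₁ e)))) (proj₂ (proj₁ (proj₂ (proj₁ e))))
    rows (_ , PΘQ) (p₀εq₀ , _) = centralises-rows {α} {β} {ε} C PΘQ p₀εq₀
    same-class : ∀ {e f : E} → _∼_ κ e f → Good e → _∼_ ε (proj₁ (proj₁ (proj₁ (proj₁ f)))) (proj₂ (proj₁ (proj₁ (proj₁ f))))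
    same-class (pp , qq) (pq , _) = ∼-trans ε (∼-sym ε pp) (∼-trans ε pq qq)
    follow : ∀ {e f : E} → Star (λ e f → _∼_ (κ ⊓ μ) e f ⊎ _∼_ (ν ⊓ κ) e f) e f → Good e → Good f
    follow nil g = g
    follow {e} {g} (_◅_ {j = f} (inj₁ (κef , q₁δq₁′)) s) h =
      follow {f} {g} s (same-class {e} {f} κef h , ∼-trans δ (proj₂ h) q₁δq₁′)
    follow {e} {g} (_◅_ {j = f} (inj₂ ((_ , p₁εp₁′) , κef)) s) h =
      follow {f} {g} s (p₀′εq₀′ , ∼-trans δ (proj₂ h) (app ε⊆δ (∼-trans ε (∼-sym ε (rows e h))
        (∼-trans ε p₁εp₁′ (centralises-rows {α} {β} {ε} C (proj₂ f) p₀′εq₀′)))))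
      where p₀′εq₀′ = same-class {e} {f} κef h

-- The commutator in a modular variety

module _ {S : Signature} (𝒱 : Variety S ℓ) (mod : CongruenceModular 𝒱)
         {A : Algebra S ℓ} (A∈𝒱 : _⊨_ S A 𝒱) where
  open Algebra A

  private
    modular : ∀ (β α : Congruence A) → Modular (Con (pairs (matrixCongruence β α)))
    modular β α = mod (pairs (matrixCongruence β α)) (pairs-⊨ (matrixCongruence β α) 𝒱 (pairs-⊨ α 𝒱 A∈𝒱))

  -- Exchanging the blocks of `t` turns an instance for `(α , β)` into a matrix for `(β , α)`. Its
  -- rows run from `b` to `a`, because `shift` carries a relation from the second column to the
  -- first.
  centralises-swap : ∀ {α β ε δ : Congruence A} → Centralises β α ε → ε ⊆ δ → Centralises α β δ
  centralises-swap {α} {β} {ε} {δ} C ε⊆δ t a b c d ab cd = shift {α = α} {β} {ε} {δ} (modular β α) C ε⊆δ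
    {h = eval-compatible α t Sum.[ ∼-sym α ∘ ab , (λ _ → ∼-refl α) ]}
    {k = eval-compatible α t Sum.[ ∼-sym α ∘ ab , (λ _ → ∼-refl α) ]}
    (record
      { term = rename Sum.swap t
      ; a = c ; b = d ; c = b ; d = a
      ; a∼b = cd ; c∼d = ∼-sym α ∘ ab
      ; ≈x = swapped b c ; ≈y = swapped a c ; ≈u = swapped b d ; ≈v = swapped a d
      } ◅ nil)
    where
    swapped : ∀ e g → eval (rename Sum.swap t) Sum.[ g , e ] ≈ eval t Sum.[ e , g ]
    swapped e g = eval-rename {A = A} Sum.swap t λ { (inj₁ _) → refl ; (inj₂ _) → refl }

  -- The definition gives the term condition modulo the commutator itself; the freedom of `δ` in
  -- `centralises-swap` extends it to every larger congruence, with the arguments exchanged.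
  commutator⊆⇒centralises : ∀ {α β δ : Congruence A} → [ α , β ] ⊆ δ → Centralises β α δ
  commutator⊆⇒centralises {α} {β} {δ} = centralises-swap {β} {α} {[ α , β ]} {δ} (commutator-centralises α β)

  commutator-comm : ∀ {α β : Congruence A} → [ α , β ] ⊆ [ β , α ]
  commutator-comm {α} {β} = commutator-least α β [ β , α ] (commutator⊆⇒centralises ⊆-refl)

  -- Chains are handled in the left block, so symmetry first moves the join there.
  commutator-⊔-least : ∀ {α β γ δ : Congruence A} → [ α , β ] ⊆ δ → [ α , γ ] ⊆ δ → [ α , β ⊔ᶜ γ ] ⊆ δ
  commutator-⊔-least {α} {β} {γ} {δ} h k = ⊆-trans commutator-comm (commutator-least (β ⊔ᶜ γ) α δ
    (centralises-⊔ˡ {α = β} {γ} {α} {δ} (commutator⊆⇒centralises h) (commutator⊆⇒centralises k)))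

  -- The diagonal is a one-element subalgebra of pairs α modulo
  -- matrixCongruence ∇ α, so that congruence relates (x , y) to (y , y).
  ⊆commutator-∇ : (∀ a → ExcludedMiddle a) → Semidegenerate 𝒱 → ∀ {α : Congruence A} → α ⊆ [ α , ∇ ]
  ⊆commutator-∇ em sd {α} = incl λ {x} {y} h →
    shift {ε = [ α , ∇ ]} {[ α , ∇ ]} (modular ∇ α) (commutator⊆⇒centralises ⊆-refl) ⊆-refl
      (collapse ((x , y) , h) ((y , y) , ∼-refl α)) (∼-refl [ α , ∇ ])
    where
    Θ = matrixCongruence ∇ α
    idempotent : Carrier → HasOneElementSubalgebra (quotient Θ)
    idempotent a = ((a , a) , ∼-refl α) , λ f xs hs → ∼-trans Θ (compatible Θ f hs) (matrix-diagonal _ ◅ nil)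
    collapse : ∀ P Q → _∼_ Θ P Q
    collapse P Q with em ℓ {_∼_ Θ P Q}
    ... | yes h = h
    ... | no ¬h = contradiction (idempotent (proj₁ (proj₁ P)))
                    (sd (quotient Θ) (quotient-⊨ 𝒱 Θ (pairs-⊨ α 𝒱 A∈𝒱)) (P , Q , ¬h))

-- Compactness, primes and the open sets D(α)

module _ {S : Signature} {A : Algebra S ℓ} where
  open Algebra A

  generatedBy : ∀ {n} → Vector Carrier n → Vector Carrier n → Congruence A
  generatedBy l r = Cg (λ x y → ∃[ i ] (l i ≈ x × r i ≈ y))

  generatedBy-least : ∀ {n} {l r : Vector Carrier n} {θ : Congruence A} →
                      (∀ i → _∼_ θ (l i) (r i)) → generatedBy l r ⊆ θ
  generatedBy-least {θ = θ} h = Cg-least θ λ (i , l≈x , r≈y) →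
    ∼-trans θ (≈⇒∼ θ (sym l≈x)) (∼-trans θ (h i) (≈⇒∼ θ r≈y))

  ⊔ᶜ-swap : ∀ (α β : Congruence A) → α ⊔ᶜ β ⊆ β ⊔ᶜ α
  ⊔ᶜ-swap α β = ⊔ᶜ-least (⊆⊔ᶜʳ β α) (⊆⊔ᶜˡ β α)

  -- Compactness is applied to principal congruences of pairs of `θ`, each joined with `χ`, so that
  -- a finite subfamily is just a finite list of pairs of `θ`.
  finite-cover : ∀ {κ : Congruence A} → Compact κ → ∀ {θ χ : Congruence A} → κ ⊆ θ ⊔ᶜ χ →
    ∃[ n ] Σ[ l ∈ Vector Carrier n ] Σ[ r ∈ Vector Carrier n ]
    (∀ i → _∼_ θ (l i) (r i)) × κ ⊆ generatedBy l r ⊔ᶜ χ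
  finite-cover compact {θ} {χ} κ⊆θ∨χ =
      length is , proj₁ ∘ proj₁ ∘ lookup is , proj₂ ∘ proj₁ ∘ lookup is , proj₂ ∘ lookup is
    , ⊆-trans (proj₂ finite) (⋁-least (restrict family is) λ (i , i∈is) →
        ⊔ᶜ-least (Cg-least (γ ⊔ᶜ χ) λ { (≡.refl , ≡.refl) → base (inj₁ (base (index i∈is ,
          reflexive (≡.cong (proj₁ ∘ proj₁) (≡.sym (lookup-index i∈is))) ,
          reflexive (≡.cong (proj₂ ∘ proj₁) (≡.sym (lookup-index i∈is)))))) }) (⊆⊔ᶜʳ γ χ))
    where
    I : Set _
    I = Σ[ (x , y) ∈ Carrier × Carrier ] _∼_ θ x y
    family : I → Congruence A
    family ((x , y) , _) = Cg (λ u v → u ≡ x × v ≡ y) ⊔ᶜ χ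
    finite = compact family (⊆-trans κ⊆θ∨χ (Cg-least (⋁ family) λ {x} → Sum.[
      (λ h → base ((_ , h) , base (inj₁ (base (≡.refl , ≡.refl))))) ,
      -- Any index serves for a pair of `χ`; the reflexive pair `(x , x)` is always available.
      (λ h → base (((x , x) , ∼-refl θ) , base (inj₂ h))) ]))
    is = proj₁ finite
    γ = generatedBy (proj₁ ∘ proj₁ ∘ lookup is) (proj₂ ∘ proj₁ ∘ lookup is)

  complements-cover : ∀ (α α′ : Congruence A) → Complements (Con A) α α′ →
                      ∀ (φ : Spec A) → α ⊆ proj₁ φ → ¬ α′ ⊆ proj₁ φ
  complements-cover α α′ ((_ , ∇⊆) , _) (φ , proper , _) h k = proper (incl _ , ⊆-trans ∇⊆ (⊔ᶜ-least h k))

  prime-⊓ : ∀ (α β : Congruence A) (φ : Spec A) → α ⊓ β ⊆ proj₁ φ → α ⊆ proj₁ φ ⊎ β ⊆ proj₁ φ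
  prime-⊓ α β (φ , _ , prime) h = prime α β (⊆-trans (commutator⊆⊓ α β) h)

  complements-split : ∀ (α α′ : Congruence A) → Complements (Con A) α α′ →
                      ∀ (φ : Spec A) → α ⊆ proj₁ φ ⊎ α′ ⊆ proj₁ φ
  complements-split α α′ (_ , (⊆Δ , _)) φ = prime-⊓ α α′ φ (⊆-trans ⊆Δ (incl (≈⇒∼ (proj₁ φ))))

  D-⊔ : (∀ a → ExcludedMiddle a) → ∀ (α β : Congruence A) → D A (α ⊔ᶜ β) ≐ D A α ∪ D A β
  D-⊔ em α β = (λ {φ} n → decidable-stable (em ℓ) λ k →
                  n (⊔ᶜ-least (decidable-stable (em ℓ) (k ∘ inj₁)) (decidable-stable (em ℓ) (k ∘ inj₂))))
             , Sum.[ (λ n h → n (⊆-trans (⊆⊔ᶜˡ α β) h)) , (λ n h → n (⊆-trans (⊆⊔ᶜʳ α β) h)) ]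

  D-complement : ∀ (α α′ : Congruence A) → Complements (Con A) α α′ → D A α′ ≐ ∁ (D A α)
  D-complement α α′ c =
      (λ {φ} n k → Sum.[ k , n ] (complements-split α α′ c φ))
    , (λ {φ} n k → n λ h → complements-cover α α′ c φ h k)

  D-clopen : ∀ (α : Congruence A) → Complemented (Con A) α → IsClopen A (D A α)
  D-clopen α (α′ , c) = (α , id , id) , (α′ , swap (D-complement α α′ c))

  D-⊓ : ∀ (α β : Congruence A) → D A (α ⊓ β) ≐ D A α ∩ D A β
  D-⊓ α β = (λ n → (λ h → n (⊆-trans (incl proj₁) h)) , (λ h → n (⊆-trans (incl proj₂) h)))
          , (λ {φ} (n , n′) h → Sum.[ n , n′ ] (prime-⊓ α β φ h))

  -- Every prime contains `α` or `β`, hence `[ α , β ]`, whose radical is therefore that of `Δ`. So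
  -- `α` and `β` are complements in the reticulation, and a preimage `γ` of `α` lies in the same
  -- primes.
  complemented-representative : (∇c : Compact (∇ {A = A})) (cl : CommutatorClosed A) (mod : Modular (Con A)) →
    PreservesBooleanCentre A ∇c cl mod → ∀ {α β : Congruence A} → Compact α → Compact β → ∇ ⊆ α ⊔ᶜ β →
    (∀ (φ : Spec A) → α ⊆ proj₁ φ ⊎ β ⊆ proj₁ φ) → Σ[ γ ∈ Centre (Con A) ] D A (proj₁ γ) ≐ D A α
  complemented-representative ∇c cl mod preserves {α} {β} α-compact β-compact ∇⊆α∨β split = γ
    , (λ {φ} n α⊆φ → n (ρ⇒⊆ A {proj₁ γ} {α} (proj₁ ργ⇔ρα) φ α⊆φ))
    , (λ {φ} n γ⊆φ → n (ρ⇒⊆ A {α} {proj₁ γ} (proj₂ ργ⇔ρα) φ γ⊆φ))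
    where
    centre : Centre (Reticulation A ∇c cl)
    centre = (α , α-compact) , (β , β-compact)
      , (ρ-mono A {α ⊔ᶜ β} {∇} (incl _) , ρ-mono A {∇} {α ⊔ᶜ β} ∇⊆α∨β)
      , ( (λ h φ _ → h φ (Sum.[ ⊆-trans (commutator⊆ˡ {α = α} {β}) , ⊆-trans (commutator⊆ʳ {α = α} {β}) ] (split φ)))
        , ρ-mono A {Δ} {[ α , β ]} (incl (≈⇒∼ [ α , β ])))
    γ : Centre (Con A)
    γ = proj₁ (preserves centre)
    ργ⇔ρα : ρ A (proj₁ γ) ⇔ ρ A α
    ργ⇔ρα = proj₂ (preserves centre) {γ} (⊆-refl , ⊆-refl)

  -- The union of a chain of proper congruences is proper since `∇` is compact, so Zorn's lemma
  -- applies.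
  maximal-above : (∀ a → ExcludedMiddle a) → (∀ c ℓ₁ ℓ₂ → ZornsLemma c ℓ₁ ℓ₂) → Compact (∇ {A = A}) →
    ∀ (θ : Congruence A) → ¬ ∇ ⊆ θ →
    ∃[ φ ] θ ⊆ φ × ¬ ∇ ⊆ φ × (∀ ψ → φ ⊆ ψ → ¬ ∇ ⊆ ψ → ψ ⊆ φ)
  maximal-above em zorn ∇c θ θ-proper =
    let (φ , θ⊆φ , φ-proper) , maximal = zorn (lsuc ℓ) ℓ ℓ poset upper-bound
    in φ , θ⊆φ , φ-proper , λ ψ φ⊆ψ ψ-proper → proj₁ (maximal (ψ , ⊆-trans θ⊆φ φ⊆ψ , ψ-proper) φ⊆ψ)
    where
    Above : Set (lsuc ℓ)
    Above = Σ[ φ ∈ Congruence A ] (θ ⊆ φ × ¬ ∇ ⊆ φ)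

    poset : Poset (lsuc ℓ) ℓ ℓ
    poset = On.poset {B = Above} (BoundedLattice.poset (Con A)) proj₁

    module _ (C : Pred Above (lsuc ℓ))
             (linear : ∀ φ ψ → C φ → C ψ → proj₁ φ ⊆ proj₁ ψ ⊎ proj₁ ψ ⊆ proj₁ φ) where

      -- Adjoining `θ` to the chain gives the empty chain an upper bound too.
      data Member : Pred Above (lsuc ℓ) where
        bottom : Member (θ , ⊆-refl , θ-proper)
        member : ∀ {φ} → C φ → Member φ

      compare : ∀ {φ ψ} → Member φ → Member ψ → proj₁ φ ⊆ proj₁ ψ ⊎ proj₁ ψ ⊆ proj₁ φ
      compare {ψ = _ , θ⊆ψ , _} bottom _ = inj₁ θ⊆ψ
      compare {φ = _ , θ⊆φ , _} _ bottom = inj₂ θ⊆φ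
      compare (member c) (member d)      = linear _ _ c d

      -- The union of the chain lives one universe up; excluded middle
      -- brings it back down.
      InUnion : Carrier → Carrier → Set (lsuc ℓ)
      InUnion x y = ∃[ φ ] Member φ × _∼_ (proj₁ φ) x y

      _≃_ : Carrier → Carrier → Set ℓ
      x ≃ y = Lift ℓ (True (em (lsuc ℓ) {InUnion x y}))

      into : ∀ {x y} → InUnion x y → x ≃ y
      into = lift ∘ fromWitness

      out : ∀ {x y} → x ≃ y → InUnion x y
      out = toWitness ∘ lower

      finite-bound : ∀ {n} {xs ys : Vector Carrier n} → (∀ i → xs i ≃ ys i) →
                     ∃[ ψ ] Member ψ × (∀ i → _∼_ (proj₁ ψ) (xs i) (ys i))
      finite-bound {zero}  hs = _ , bottom , λ ()
      finite-bound {suc n} hs with out (hs zero) | finite-bound (hs ∘ suc)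
      ... | φ , φ∈ , h | ψ , ψ∈ , hs′ with compare φ∈ ψ∈
      ...   | inj₁ φ⊆ψ = ψ , ψ∈ , λ { zero → app φ⊆ψ h ; (suc i) → hs′ i }
      ...   | inj₂ ψ⊆φ = φ , φ∈ , λ { zero → h ; (suc i) → app ψ⊆φ (hs′ i) }

      ≃-trans : ∀ {x y z} → x ≃ y → y ≃ z → x ≃ z
      ≃-trans h k with out h | out k
      ... | φ , φ∈ , h′ | ψ , ψ∈ , k′ with compare φ∈ ψ∈
      ...   | inj₁ φ⊆ψ = into (ψ , ψ∈ , ∼-trans (proj₁ ψ) (app φ⊆ψ h′) k′)
      ...   | inj₂ ψ⊆φ = into (φ , φ∈ , ∼-trans (proj₁ φ) h′ (app ψ⊆φ k′))

      union : Congruence A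
      union = record
        { _∼_             = _≃_
        ; ∼-isEquivalence = record
          { refl  = into (_ , bottom , ∼-refl θ)
          ; sym   = λ h → let φ , φ∈ , h′ = out h in into (φ , φ∈ , ∼-sym (proj₁ φ) h′)
          ; trans = ≃-trans
          }
        ; ≈⇒∼             = λ h → into (_ , bottom , ≈⇒∼ θ h)
        ; compatible      = λ f hs → let ψ , ψ∈ , hs′ = finite-bound hs in into (ψ , ψ∈ , compatible (proj₁ ψ) f hs′)
        }

      -- Finitely many pairs of the union generate `∇` together with `θ`. One member contains all
      -- these pairs, and it contains `θ`, so it would not be proper.
      union-proper : ¬ ∇ ⊆ union
      union-proper ∇⊆ with finite-cover ∇c {union} {θ} (⊆-trans ∇⊆ (⊆⊔ᶜˡ union θ))
      ... | _ , _ , _ , hs , ∇⊆′ with finite-bound hs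
      ...   | (ψ , θ⊆ψ , ψ-proper) , _ , hs′ =
        ψ-proper (⊆-trans ∇⊆′ (⊔ᶜ-least (generatedBy-least {θ = ψ} hs′) θ⊆ψ))

      upper-bound : ∃[ u ] ∀ φ → C φ → proj₁ φ ⊆ proj₁ u
      upper-bound = (union , incl (λ h → into (_ , bottom , h)) , union-proper)
                  , λ φ c → incl λ h → into (φ , member c , h)

-- The Boolean centre of Con(A)

module _ {ℓ} (em : ∀ a → ExcludedMiddle a) (zorn : ∀ c ℓ₁ ℓ₂ → ZornsLemma c ℓ₁ ℓ₂)
         {S : Signature} (𝒱 : Variety S ℓ) (mod : CongruenceModular 𝒱) (sd : Semidegenerate 𝒱)
         {A : Algebra S ℓ} (A∈𝒱 : _⊨_ S A 𝒱) where

  private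
    ∇c : Compact (∇ {A = A})
    ∇c = ∇-compact em 𝒱 sd A A∈𝒱

  -- Since `α` lies in `[ α , ∇ ]` and commutators preserve joins, an inclusion may be tested on the
  -- two halves of a cover of `∇`.
  cover-⊆ : ∀ {α β γ δ : Congruence A} → ∇ ⊆ β ⊔ᶜ γ → [ α , β ] ⊆ δ → [ α , γ ] ⊆ δ → α ⊆ δ
  cover-⊆ ∇⊆ h k = ⊆-trans (⊆commutator-∇ 𝒱 mod A∈𝒱 em sd)
    (⊆-trans (commutator-mono ⊆-refl ∇⊆) (commutator-⊔-least 𝒱 mod A∈𝒱 h k))

  -- Either `β` and `φ` cover `∇`, and `α` is tested against both, or maximality absorbs `β` into
  -- `φ`.
  maximal⇒prime : ∀ {φ : Congruence A} → ¬ ∇ ⊆ φ → (∀ ψ → φ ⊆ ψ → ¬ ∇ ⊆ ψ → ψ ⊆ φ) → IsPrime φ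
  maximal⇒prime {φ} proper maximal = proper ∘ proj₂ , prime
    where
    prime : ∀ α β → [ α , β ] ⊆ φ → α ⊆ φ ⊎ β ⊆ φ
    prime α β h with em ℓ {∇ ⊆ β ⊔ᶜ φ}
    ... | yes ∇⊆ = inj₁ (cover-⊆ ∇⊆ h commutator⊆ʳ)
    ... | no ∇⊈  = inj₂ (⊆-trans (⊆⊔ᶜˡ β φ) (maximal (β ⊔ᶜ φ) (⊆⊔ᶜʳ β φ) ∇⊈))

  no-prime⇒∇⊆ : ∀ {θ : Congruence A} → (∀ (φ : Spec A) → ¬ θ ⊆ proj₁ φ) → ∇ ⊆ θ
  no-prime⇒∇⊆ {θ} none = decidable-stable (em ℓ) λ proper →
    let φ , θ⊆φ , φ-proper , maximal = maximal-above em zorn ∇c θ proper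
    in none (φ , maximal⇒prime φ-proper maximal) θ⊆φ

  -- A prime containing `α′` and `β` would contain `α` as well, so `α′` and `β` cover `∇`; moreover
  -- `[ α , α′ ]` is trivial.
  complemented-⊆ : ∀ {α β : Congruence A} → Complemented (Con A) α →
                   (∀ (φ : Spec A) → β ⊆ proj₁ φ → α ⊆ proj₁ φ) → α ⊆ β
  complemented-⊆ {α} {β} (α′ , c@(_ , (⊆Δ , _))) h = cover-⊆ {β = α′} {β}
    (no-prime⇒∇⊆ λ φ k → complements-cover α α′ c φ (h φ (⊆-trans (⊆⊔ᶜʳ α′ β) k)) (⊆-trans (⊆⊔ᶜˡ α′ β) k))
    (⊆-trans (commutator⊆⊓ α α′) (⊆-trans ⊆Δ (incl (≈⇒∼ β)))) commutator⊆ʳ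

  -- Tested on the cover by `α` and `α′`, where the second half lies below `α ⊓ α′`. Meets with `α`
  -- thereby inherit distribution over joins from the commutator.
  complemented-⊓⊆commutator : ∀ {α θ : Congruence A} → Complemented (Con A) α → α ⊓ θ ⊆ [ α , θ ]
  complemented-⊓⊆commutator {α} {θ} (α′ , (_ , ∇⊆) , (⊆Δ , _)) = cover-⊆ {β = α} {α′} ∇⊆
    (⊆-trans (commutator-mono (incl proj₂) ⊆-refl) (commutator-comm 𝒱 mod A∈𝒱))
    (⊆-trans (commutator⊆⊓ (α ⊓ θ) α′) (⊆-trans (incl λ ((h , _) , k) → h , k)
      (⊆-trans ⊆Δ (incl (≈⇒∼ [ α , θ ])))))

  -- The join is `∇` because no prime contains it. For the meet, `α′ ⊓ (α ⊔ᶜ β)` is a commutator and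
  -- so falls below `β`, which meets `β′` trivially.
  ⊔-complements : ∀ (α α′ β β′ : Congruence A) → Complements (Con A) α α′ → Complements (Con A) β β′ →
                  Complements (Con A) (α ⊔ᶜ β) (α′ ⊓ β′)
  ⊔-complements α α′ β β′ c@(_ , (αα′⊆Δ , _)) d@(_ , (ββ′⊆Δ , _)) =
      (incl _ , no-prime⇒∇⊆ λ φ k →
        let α∨β⊆φ = ⊆-trans (⊆⊔ᶜˡ (α ⊔ᶜ β) (α′ ⊓ β′)) k in
        Sum.[ complements-cover α α′ c φ (⊆-trans (⊆⊔ᶜˡ α β) α∨β⊆φ)
            , complements-cover β β′ d φ (⊆-trans (⊆⊔ᶜʳ α β) α∨β⊆φ)
            ] (prime-⊓ α′ β′ φ (⊆-trans (⊆⊔ᶜʳ (α ⊔ᶜ β) (α′ ⊓ β′)) k)))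
    , (incl (λ (h , h₁ , h₂) → app ββ′⊆Δ (app α′∧⊆β (h₁ , h) , h₂)) , incl (≈⇒∼ ((α ⊔ᶜ β) ⊓ (α′ ⊓ β′))))
    where
    α′∧⊆β : α′ ⊓ (α ⊔ᶜ β) ⊆ β
    α′∧⊆β = ⊆-trans (complemented-⊓⊆commutator (α , Complements-sym (Con A) {α} {α′} c))
      (commutator-⊔-least 𝒱 mod A∈𝒱
        (⊆-trans (commutator⊆⊓ α′ α) (⊆-trans (incl swap) (⊆-trans αα′⊆Δ (incl (≈⇒∼ β)))))
        commutator⊆ʳ)

  ⊓-complements : ∀ (α α′ β β′ : Congruence A) → Complements (Con A) α α′ → Complements (Con A) β β′ →
                  Complements (Con A) (α ⊓ β) (α′ ⊔ᶜ β′)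
  ⊓-complements α α′ β β′ c d = Complements-sym (Con A) {α′ ⊔ᶜ β′} {α ⊓ β}
    (⊔-complements α′ α β′ β (Complements-sym (Con A) {α} {α′} c) (Complements-sym (Con A) {β} {β′} d))

  complement-antitone : ∀ (α α′ β β′ : Congruence A) → Complements (Con A) α α′ → Complements (Con A) β β′ →
                        α ⊆ β → β′ ⊆ α′
  complement-antitone α α′ β β′ c d α⊆β =
    complemented-⊆ (β , Complements-sym (Con A) {β} {β′} d) λ φ α′⊆φ →
      Sum.[ (λ β⊆φ → contradiction α′⊆φ (complements-cover α α′ c φ (⊆-trans α⊆β β⊆φ))) , id ] (complements-split β β′ d φ)

  centreIsBoolean : CentreIsBoolean (Con A)
  centreIsBoolean = record
    { ∨-complemented   = λ {α} {β} (α′ , c) (β′ , d) → α′ ⊓ β′ , ⊔-complements α α′ β β′ c d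
    ; ∧-complemented   = λ {α} {β} (α′ , c) (β′ , d) → α′ ⊔ᶜ β′ , ⊓-complements α α′ β β′ c d
    ; isBooleanAlgebra = isBooleanAlgebraʳ (record
      { isDistributiveLattice = isDistributiveLatticeʳʲᵐ (record
        { isLattice    = record
          { isEquivalence = On.isEquivalence proj₁ L.isEquivalence
          ; ∨-comm        = λ (α , _) (β , _) → L.∨-comm α β
          ; ∨-assoc       = λ (α , _) (β , _) (γ , _) → L.∨-assoc α β γ
          ; ∨-cong        = λ {(α , _)} {(α′ , _)} {(β , _)} {(β′ , _)} → L.∨-cong {α} {α′} {β} {β′}
          ; ∧-comm        = λ (α , _) (β , _) → L.∧-comm α β
          ; ∧-assoc       = λ (α , _) (β , _) (γ , _) → L.∧-assoc α β γ
          ; ∧-cong        = λ {(α , _)} {(α′ , _)} {(β , _)} {(β′ , _)} → L.∧-cong {α} {α′} {β} {β′}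
          ; absorptive    = (λ (α , _) (β , _) → proj₁ L.absorptive α β)
                          , (λ (α , _) (β , _) → proj₂ L.absorptive α β)
          }
        ; ∨-distribʳ-∧ = λ (α , α′ , a) (β , β′ , b) (γ , γ′ , c) →
              ⊔ᶜ-least {α = β ⊓ γ} {α} {(β ⊔ᶜ α) ⊓ (γ ⊔ᶜ α)}
                (incl λ (h , k) → base (inj₁ h) , base (inj₁ k)) (incl λ h → base (inj₂ h) , base (inj₂ h))
            -- The smaller side is complemented, so this inclusion need only be checked on primes.
            , complemented-⊆ {(β ⊔ᶜ α) ⊓ (γ ⊔ᶜ α)} {(β ⊓ γ) ⊔ᶜ α}
                ( (β′ ⊓ α′) ⊔ᶜ (γ′ ⊓ α′)
                , ⊓-complements (β ⊔ᶜ α) (β′ ⊓ α′) (γ ⊔ᶜ α) (γ′ ⊓ α′)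
                    (⊔-complements β β′ α α′ b a) (⊔-complements γ γ′ α α′ c a))
                λ φ k → let α⊆φ = ⊆-trans (⊆⊔ᶜʳ (β ⊓ γ) α) k in
                  Sum.[ (λ β⊆φ → ⊆-trans (incl proj₁) (⊔ᶜ-least β⊆φ α⊆φ))
                      , (λ γ⊆φ → ⊆-trans (incl proj₂) (⊔ᶜ-least γ⊆φ α⊆φ))
                      ] (prime-⊓ β γ φ (⊆-trans (⊆⊔ᶜˡ (β ⊓ γ) α) k))
        })
      ; ∨-complementʳ = λ (_ , _ , c) → proj₁ c
      ; ∧-complementʳ = λ (_ , _ , c) → proj₂ c
      ; ¬-cong        = λ {(α , α′ , c)} {(β , β′ , d)} (α⊆β , β⊆α) →
          complement-antitone β β′ α α′ d c β⊆α , complement-antitone α α′ β β′ c d α⊆β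
      })
    }
    where
    module L = IsLattice (LatticeProperties.isAlgLattice (BoundedLattice.lattice (Con A)))

  -- Complemented congruences and clopen sets of Spec(A)

  D-reflects-≐ : ∀ {α β : Congruence A} → Complemented (Con A) α → Complemented (Con A) β →
                 D A α ≐ D A β → α ≋ β
  D-reflects-≐ c d (h , k) =
      complemented-⊆ c (λ φ β⊆φ → decidable-stable (em ℓ) λ n → h {φ} n β⊆φ)
    , complemented-⊆ d (λ φ α⊆φ → decidable-stable (em ℓ) λ n → k {φ} n α⊆φ)

  -- `finite-cover` first shrinks `θ`, then shrinks `χ` against the result. The open set does not
  -- shrink: a prime in `U` contains `χ`, hence the new `β`, and being proper it cannot contain the
  -- new `α`.
  clopen⇒compact : ∀ {U : Pred (Spec A) ℓ} → IsClopen A U →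
    ∃[ α ] ∃[ β ] Compact α × Compact β × ∇ ⊆ α ⊔ᶜ β ×
    (∀ (φ : Spec A) → α ⊆ proj₁ φ ⊎ β ⊆ proj₁ φ) × U ≐ D A α
  clopen⇒compact {U} ((θ , U⇒Dθ , Dθ⇒U) , (χ , ∁U⇒Dχ , Dχ⇒∁U)) =
    let n , l , r , l∼r , ∇⊆α∨χ = finite-cover ∇c {θ} {χ} (no-prime⇒∇⊆ cover)
        k , l′ , r′ , l′∼r′ , ∇⊆β∨α =
          finite-cover ∇c {χ} {generatedBy l r} (⊆-trans ∇⊆α∨χ (⊔ᶜ-swap (generatedBy l r) χ))
        α⊆θ = generatedBy-least {θ = θ} l∼r
        β⊆χ = generatedBy-least {θ = χ} l′∼r′
    in generatedBy l r , generatedBy l′ r′ , Cg-finite-compact l r , Cg-finite-compact l′ r′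
     , ⊆-trans ∇⊆β∨α (⊔ᶜ-swap (generatedBy l′ r′) (generatedBy l r))
     , (λ φ → Sum.map (⊆-trans α⊆θ) (⊆-trans β⊆χ) (split φ))
     , (λ {φ} u α⊆φ → proj₁ (proj₂ φ) (incl _ , ⊆-trans ∇⊆β∨α (⊔ᶜ-least (⊆-trans β⊆χ (inside φ u)) α⊆φ)))
     , (λ n → Dθ⇒U (n ∘ ⊆-trans α⊆θ))
    where
    inside : ∀ φ → U φ → χ ⊆ proj₁ φ
    inside φ u = decidable-stable (em ℓ) λ n → Dχ⇒∁U n u
    outside : ∀ φ → ¬ U φ → θ ⊆ proj₁ φ
    outside φ n = decidable-stable (em ℓ) (n ∘ Dθ⇒U)
    split : ∀ φ → θ ⊆ proj₁ φ ⊎ χ ⊆ proj₁ φ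
    split φ with em ℓ {U φ}
    ... | yes u = inj₂ (inside φ u)
    ... | no n  = inj₁ (outside φ n)
    cover : ∀ φ → ¬ θ ⊔ᶜ χ ⊆ proj₁ φ
    cover φ h with em ℓ {U φ}
    ... | yes u = U⇒Dθ u (⊆-trans (⊆⊔ᶜˡ θ χ) h)
    ... | no n  = ∁U⇒Dχ n (⊆-trans (⊆⊔ᶜʳ θ χ) h)

  D-surjective : (cl : CommutatorClosed A) → PreservesBooleanCentre A ∇c cl (mod A A∈𝒱) →
    ∀ {U : Pred (Spec A) ℓ} → IsClopen A U → Σ[ γ ∈ Centre (Con A) ] D A (proj₁ γ) ≐ U
  D-surjective cl preserves clopen =
    let α , β , α-compact , β-compact , ∇⊆α∨β , split , U⇒Dα , Dα⇒U = clopen⇒compact clopen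
        γ , Dγ⇒Dα , Dα⇒Dγ = complemented-representative ∇c cl (mod A A∈𝒱) preserves α-compact β-compact ∇⊆α∨β split
    in γ , (λ {φ} n → Dα⇒U {φ} (Dγ⇒Dα {φ} n)) , (λ {φ} u → Dα⇒Dγ {φ} (U⇒Dα {φ} u))

theorem4p9 : ∀ {ℓ} (em : ∀ a → ExcludedMiddle a) (zorn : ∀ c ℓ₁ ℓ₂ → ZornsLemma c ℓ₁ ℓ₂)
    (S : Signature) (𝒱 : Variety S ℓ) (mod : CongruenceModular 𝒱) (sd : Semidegenerate 𝒱)
    (A : Algebra S ℓ) (A∈𝒱 : _⊨_ S A 𝒱) (cl : CommutatorClosed A) →
    PreservesBooleanCentre A (∇-compact em 𝒱 sd A A∈𝒱) cl (mod A A∈𝒱) →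
    Σ[ clopen ∈ (∀ α → Complemented (Con A) α → IsClopen A (D A α)) ]
    Σ[ bool ∈ CentreIsBoolean (Con A) ]
    IsBooleanIsomorphism (centreAlgebra (Con A) bool) (Clop A em) (λ (α , c) → D A α , clopen α c)
theorem4p9 em zorn S 𝒱 mod sd A A∈𝒱 cl preserves =
    D-clopen
  , centreIsBoolean em zorn 𝒱 mod sd A∈𝒱
  , record
    { isLatticeIsomorphism = record
      { isLatticeMonomorphism = record
        { isLatticeHomomorphism = record
          { isRelHomomorphism = record { cong = λ (α⊆β , β⊆α) → (λ n → n ∘ ⊆-trans α⊆β) , (λ n → n ∘ ⊆-trans β⊆α) }
          ; ∧-homo            = λ (α , _) (β , _) → D-⊓ α β
          ; ∨-homo            = λ (α , _) (β , _) → D-⊔ em α β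
          }
        ; injective = λ {(_ , c)} {(_ , d)} → D-reflects-≐ em zorn 𝒱 mod sd A∈𝒱 c d
        }
      ; surjective = λ (U , clopen) →
          let γ , Dγ⇒U , U⇒Dγ = D-surjective em zorn 𝒱 mod sd A∈𝒱 cl preserves clopen
          in γ , λ (β⊆γ , γ⊆β) → (λ n → Dγ⇒U (n ∘ ⊆-trans β⊆γ)) , (λ u → U⇒Dγ u ∘ ⊆-trans γ⊆β)
      }
    ; ¬-homo = λ (α , α′ , c) → D-complement α α′ c
    ; ⊤-homo = _ , λ {φ} _ ∇⊆φ → proj₁ (proj₂ φ) (incl _ , ∇⊆φ)
    ; ⊥-homo = (λ {φ} n → contradiction (incl (≈⇒∼ (proj₁ φ))) n) , λ ()
    }
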